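{- Let $t:\mathbb{N}\to\mathbb{N}$ be a non-decreasing function with $\lim_{n\to\infty} n/t(n)=0$. Then the sequence $L^{(t)}$ is completely uniformly distributed.
   Context: Here $\mathbb{N}=\{1,2,3,\dots\}$. For integers $b,k\ge 1$, a $b$-ary de Bruijn sequence of order $k$ is a sequence of length $b^k$ over $\{0,1,\dots,b-1\}$ which, viewed as a cyclic sequence, contains every sequence of length $k$ over $\{0,\dots,b-1\}$ exactly once as a contiguous subsequence (including those wrapping around the end). The $b$-ary Ford sequence of order $k$, $F^{(b,k)}$, is the lexicographically least $b$-ary de Bruijn sequence of order $k$. For $n\in\mathbb{N}$, write $F^{(n,n)}=f_1,\dots,f_{n^n}$ and let $C^{(n)}$ be the finite sequence $f_1/n, f_2/n,\dots,f_{n^n}/n$. Let $D^{(n,t)}$ be the concatenation of $t(n)$ consecutive copies of $C^{(n)}$, and let $L^{(t)}$ be the infinite sequence obtained by concatenating $D^{(1,t)},D^{(2,t)},D^{(3,t)},\dots$ in this order. A sequence $(x_i)_{i\ge1}$ in $[0,1)$ is completely uniformly distributed if for every integer $k\ge1$ the sequence of vectors $(x_i,x_{i+1},\dots,x_{i+k-1})_{i\ge1}$ is uniformly distributed in $[0,1)^k$, i.e. for every box $I=[u_1,v_1)\times\dots\times[u_k,v_k)\subseteq[0,1)^k$, the proportion of indices $i\le N$ with $(x_i,\dots,x_{i+k-1})\in I$ tends to $\prod_d (v_d-u_d)$ as $N\to\infty$.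
   Formalization: In the definition of complete uniform distribution, the endpoints u_d, v_d of the boxes (and the tolerances in the limits) range over rational numbers instead of real numbers. -}

module Defs where

open import Data.Nat as ℕ using (ℕ; zero; suc; _+_; _*_; _∸_; _^_; _%_)
open import Data.Integer using (+_)
open import Data.Rational as ℚ using (ℚ; 0ℚ; 1ℚ; _/_)
open import Data.Rational.Properties as ℚP using ()
open import Data.Fin using (Fin; toℕ)
open import Data.List using (List; []; _∷_; length; map; upTo; filter)
open import Data.List.Relation.Unary.All using (All)
open import Data.Bool using (Bool; true; false; _∧_; if_then_else_)
open import Data.Product using (Σ; _×_; _,_; ∃)
open import Relation.Binary.PropositionalEquality using (_≡_)
open import Relation.Nullary.Decidable using (⌊_⌋)

-- m / n as a rational number (with the convention m / 0 = 0, never used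
-- under the hypotheses of the theorem)
frac : ℕ → ℕ → ℚ
frac m zero    = 0ℚ
frac m (suc k) = (+ m) / suc k

at : List ℕ → ℕ → ℕ
at []       _       = 0
at (x ∷ xs) zero    = x
at (x ∷ xs) (suc i) = at xs i

cyclicWindow : List ℕ → ℕ → ℕ → List ℕ
cyclicWindow s i k with length s
... | zero    = map (λ j → 0) (upTo k)
... | suc len = map (λ j → at s ((i + j) % suc len)) (upTo k)

Word : ℕ → List ℕ → Set
Word b w = All (λ x → x ℕ.< b) w

IsDeBruijn : ℕ → ℕ → List ℕ → Set
IsDeBruijn b k s =
  length s ≡ b ^ k × Word b s ×
  ((w : List ℕ) → length w ≡ k → Word b w →
     (Σ ℕ λ i → i ℕ.< b ^ k × cyclicWindow s i k ≡ w) ×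
     ((i j : ℕ) → i ℕ.< b ^ k → j ℕ.< b ^ k →
        cyclicWindow s i k ≡ w → cyclicWindow s j k ≡ w → i ≡ j))

data _≤lex_ : List ℕ → List ℕ → Set where
  []≤   : ∀ {ys} → [] ≤lex ys
  here  : ∀ {x y xs ys} → x ℕ.< y → (x ∷ xs) ≤lex (y ∷ ys)
  there : ∀ {x xs ys} → xs ≤lex ys → (x ∷ xs) ≤lex (x ∷ ys)

IsFord : ℕ → ℕ → List ℕ → Set
IsFord b k s = IsDeBruijn b k s × ((s' : List ℕ) → IsDeBruijn b k s' → s ≤lex s')

-- Given a family F with F n = F^(n,n) for n ≥ 1 and t, the sequence L^(t),
-- 0-based: (L F t) i is x_{i+1}.  Block n is D^(n,t), of length
-- t(n) * |F n|, whose m-th entry is f_{(m mod |F n|)+1} / n.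
-- The fuel argument is only a termination device: under the hypotheses
-- every block is nonempty, so fuel i+1 starting from block 1 always suffices.
Lgo : (ℕ → List ℕ) → (ℕ → ℕ) → ℕ → ℕ → ℕ → ℚ
Lgo F t zero       n m = 0ℚ
Lgo F t (suc fuel) n m with length (F n)
... | zero    = Lgo F t fuel (suc n) m
... | suc len =
  if ⌊ m ℕ.<? t n * suc len ⌋
  then frac (at (F n) (m % suc len)) n
  else Lgo F t fuel (suc n) (m ∸ t n * suc len)

L : (ℕ → List ℕ) → (ℕ → ℕ) → ℕ → ℚ
L F t i = Lgo F t (suc i) 1 i

inBox : (k : ℕ) → (Fin k → ℚ) → (Fin k → ℚ) → (Fin k → ℚ) → Bool
inBox zero    u v x = true
inBox (suc k) u v x =
  ⌊ u Data.Fin.zero ℚP.≤? x Data.Fin.zero ⌋ ∧ ⌊ x Data.Fin.zero ℚP.<? v Data.Fin.zero ⌋ ∧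
  inBox k (λ d → u (Data.Fin.suc d)) (λ d → v (Data.Fin.suc d)) (λ d → x (Data.Fin.suc d))

volume : (k : ℕ) → (Fin k → ℚ) → (Fin k → ℚ) → ℚ
volume zero    u v = 1ℚ
volume (suc k) u v =
  (v Data.Fin.zero ℚ.- u Data.Fin.zero) ℚ.* volume k (λ d → u (Data.Fin.suc d)) (λ d → v (Data.Fin.suc d))

countIn : (ℕ → ℚ) → (k : ℕ) → (Fin k → ℚ) → (Fin k → ℚ) → ℕ → ℕ
countIn x k u v N =
  length (filter (λ i → Data.Bool._≟_ (inBox k u v (λ d → x (i + toℕ d))) true) (upTo N))

-- a box contained in [0,1)^k (closed upper endpoint 1 allowed since
-- intervals are half-open)
IsBox : (k : ℕ) → (Fin k → ℚ) → (Fin k → ℚ) → Set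
IsBox k u v = (d : Fin k) → (0ℚ ℚ.≤ u d) × (u d ℚ.≤ v d) × (v d ℚ.≤ 1ℚ)

CompletelyUD : (ℕ → ℚ) → Set
CompletelyUD x =
  (k : ℕ) → 1 ℕ.≤ k → (u v : Fin k → ℚ) → IsBox k u v →
  (ε : ℚ) → 0ℚ ℚ.< ε →
  ∃ λ N₀ → (N : ℕ) → N₀ ℕ.≤ N → 1 ℕ.≤ N →
    ℚ.∣ frac (countIn x k u v N) N ℚ.- volume k u v ∣ ℚ.< ε

{-# OPTIONS --safe #-}
module Submission where

-- Only the de Bruijn property is used: the cyclic windows of length n of
-- F^(n,n) are exactly the words of length n, so one cycle of block n meets a box
-- of dimension k ≤ n exactly n^(n-k) ∏ c_d times, where c_d counts the a < n with
-- a / n in the d-th side; as c_d differs from n (v_d - u_d) by at most 1, the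
-- relative error of a cycle is O(k / n).  The last cycle of each block and an
-- incomplete final cycle are estimated trivially.  They are negligible since
-- 1 / t(n) → 0 and (n+1)^(n+1) ≤ 8 n · n^n = o(t(n) n^n), respectively.
-- Side lengths, volumes and errors are kept in ℕ by clearing denominators.

open import Defs
open import Algebra.Properties.Group using (⁻¹-anti-homo-//)
open import Data.Bool as Bool using (Bool; true; false; _∧_)
open import Data.Bool.Properties using (∧-assoc)
open import Data.Fin as Fin using (Fin; toℕ)
import Data.Fin.Properties as Fin
import Data.Integer as ℤ
import Data.Integer.Properties as ℤ
open import Data.List using (List; []; _∷_; _++_; length; map; upTo; applyUpTo; filter; cartesianProductWith)
open import Data.List.Properties using (length-++; length-filter; filter-++; length-upTo; map-upTo; length-applyUpTo; ∷-injective)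
open import Data.List.Membership.Propositional using (_∈_)
open import Data.List.Membership.Propositional.Properties using (∈-cartesianProductWith⁺; ∈-cartesianProductWith⁻; ∈-applyUpTo⁺; ∈-applyUpTo⁻; ∈-upTo⁺; ∈-upTo⁻)
open import Data.List.Membership.Propositional.Properties.WithK using (unique∧set⇒bag)
open import Data.List.Relation.Binary.BagAndSetEquality using (∼bag⇒↭)
open import Data.List.Relation.Binary.Permutation.Propositional using (_↭_)
open import Data.List.Relation.Binary.Permutation.Propositional.Properties using (↭-length; filter-↭)
open import Data.List.Relation.Unary.All using (All; []; _∷_)
open import Data.List.Relation.Unary.AllPairs using ([]; _∷_)
open import Data.List.Relation.Unary.Any using (here; there)
open import Data.List.Relation.Unary.Unique.Propositional using (Unique)
import Data.List.Relation.Unary.Unique.Propositional.Properties as Unique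
open import Data.Nat as ℕ using (ℕ; zero; suc; _+_; _*_; _∸_; _^_; _%_; _/_; _≤_; _<_; z≤n; s≤s; z<s; NonZero; ∣_-_∣)
open import Data.Nat.DivMod
open import Data.Nat.Properties
open import Data.Nat.Tactic.RingSolver using (solve-∀)
open import Data.Product using (∃; ∃₂; _×_; _,_; proj₁; proj₂)
open import Data.Rational using (ℚ; 0ℚ; 1ℚ; toℚᵘ; ↥_; ↧ₙ_)
import Data.Rational as ℚ
import Data.Rational.Properties as ℚ
open import Data.Rational.Solver using (module +-*-Solver)
import Data.Rational.Unnormalised as ℚᵘ
import Data.Rational.Unnormalised.Properties as ℚᵘ
open import Data.Sum using (_⊎_; inj₁; inj₂)
open import Function using (_∘_; id; mk⇔)
open import Relation.Binary.PropositionalEquality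
open import Relation.Nullary using (yes; no; contradiction)
open import Relation.Nullary.Decidable using (⌊_⌋; isYes≗does; does-⇔)

-- No limit occurs after the start: ε is replaced by one natural number `K`, and every estimate
-- takes the form `K * disc ≤ c * (Q * length)` with an absolute constant `c`. Since the discrepancy
-- is subadditive over adjacent ranges, such estimates add up to a bound with `c = 11`, and
-- `K = 12 * ↧ₙ ε` then beats ε. What shapes the cutting of the range is that consecutive cycle
-- lengths have unbounded ratio, about e times n: a piece of a single cycle of the next block can
-- outweigh any fixed number of cycles of the present one. It has to be charged to the whole
-- preceding block, and that requires `K * n ≤ t n` and not merely `K ≤ t n`.

-- Counting with Boolean predicates.

count : {A : Set} → (A → Bool) → List A → ℕ
count p xs = length (filter (λ x → p x Bool.≟ true) xs)

countBelow : (ℕ → Bool) → ℕ → ℕ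
countBelow p n = count p (upTo n)

bit : Bool → ℕ
bit true  = 1
bit false = 0

module _ {A : Set} where

  count-∷ : (p : A → Bool) (x : A) (xs : List A) → count p (x ∷ xs) ≡ bit (p x) + count p xs
  count-∷ p x xs with p x
  ... | true  = refl
  ... | false = refl

  count-cong : {p q : A → Bool} (xs : List A) → (∀ x → x ∈ xs → p x ≡ q x) → count p xs ≡ count q xs
  count-cong []       p≡q = refl
  count-cong {p} {q} (x ∷ xs) p≡q = begin
    count p (x ∷ xs)         ≡⟨ count-∷ p x xs ⟩
    bit (p x) + count p xs   ≡⟨ cong₂ _+_ (cong bit (p≡q x (here refl))) (count-cong xs (λ y y∈xs → p≡q y (there y∈xs))) ⟩
    bit (q x) + count q xs   ≡⟨ count-∷ q x xs ⟨
    count q (x ∷ xs)         ∎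
    where open ≡-Reasoning

  count-++ : (p : A → Bool) (xs ys : List A) → count p (xs ++ ys) ≡ count p xs + count p ys
  count-++ p xs ys = trans (cong length (filter-++ (λ x → p x Bool.≟ true) xs ys))
                           (length-++ (filter (λ x → p x Bool.≟ true) xs))

  count≤length : (p : A → Bool) (xs : List A) → count p xs ≤ length xs
  count≤length p = length-filter (λ x → p x Bool.≟ true)

  count-↭ : (p : A → Bool) {xs ys : List A} → xs ↭ ys → count p xs ≡ count p ys
  count-↭ p xs↭ys = ↭-length (filter-↭ (λ x → p x Bool.≟ true) xs↭ys)

  -- The single equation between bits says that `r` is the disjoint union of `p` and `q`.
  count-+ : (p q r : A → Bool) (xs : List A) → (∀ x → bit (p x) + bit (q x) ≡ bit (r x)) →
            count p xs + count q xs ≡ count r xs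
  count-+ p q r []       _   = refl
  count-+ p q r (x ∷ xs) p+q rewrite count-∷ p x xs | count-∷ q x xs | count-∷ r x xs
    | sym (p+q x) | sym (count-+ p q r xs p+q) = shuffle (bit (p x)) (count p xs) (bit (q x)) (count q xs)
    where
    shuffle : ∀ a b c d → a + b + (c + d) ≡ a + c + (b + d)
    shuffle = solve-∀

count-map : {A B : Set} (p : B → Bool) (f : A → B) (xs : List A) → count p (map f xs) ≡ count (p ∘ f) xs
count-map p f []       = refl
count-map p f (x ∷ xs) = begin
  count p (f x ∷ map f xs)             ≡⟨ count-∷ p (f x) (map f xs) ⟩
  bit (p (f x)) + count p (map f xs)   ≡⟨ cong (bit (p (f x)) +_) (count-map p f xs) ⟩
  bit (p (f x)) + count (p ∘ f) xs     ≡⟨ count-∷ (p ∘ f) x xs ⟨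
  count (p ∘ f) (x ∷ xs)               ∎
  where open ≡-Reasoning

count-false : {A : Set} (xs : List A) → count (λ _ → false) xs ≡ 0
count-false []       = refl
count-false (_ ∷ xs) = count-false xs

count-true : {A : Set} (xs : List A) → count (λ _ → true) xs ≡ length xs
count-true []       = refl
count-true (_ ∷ xs) = cong suc (count-true xs)

-- The source of the product formula for boxes: membership of `x ∷ w` in a box is a condition on `x`
-- together with a condition on `w`.
count-cartesianProductWith : {A B C : Set} (f : A → B → C) (p : A → Bool) (q : B → Bool) (r : C → Bool) →
  (∀ a b → r (f a b) ≡ p a ∧ q b) → (xs : List A) (ys : List B) →
  count r (cartesianProductWith f xs ys) ≡ count p xs * count q ys
count-cartesianProductWith f p q r r≡p∧q []       ys = refl
count-cartesianProductWith f p q r r≡p∧q (x ∷ xs) ys = begin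
  count r (map (f x) ys ++ cartesianProductWith f xs ys)          ≡⟨ count-++ r (map (f x) ys) _ ⟩
  count r (map (f x) ys) + count r (cartesianProductWith f xs ys) ≡⟨ cong₂ _+_ row (count-cartesianProductWith f p q r r≡p∧q xs ys) ⟩
  bit (p x) * count q ys + count p xs * count q ys                ≡⟨ *-distribʳ-+ (count q ys) (bit (p x)) (count p xs) ⟨
  (bit (p x) + count p xs) * count q ys                           ≡⟨ cong (_* count q ys) (count-∷ p x xs) ⟨
  count p (x ∷ xs) * count q ys                                   ∎
  where
  open ≡-Reasoning
  row′ : (b : Bool) → count (λ y → b ∧ q y) ys ≡ bit b * count q ys
  row′ true  = sym (+-identityʳ _)
  row′ false = count-false ys
  row : count r (map (f x) ys) ≡ bit (p x) * count q ys
  row = trans (count-map r (f x) ys) (trans (count-cong ys (λ y _ → r≡p∧q x y)) (row′ (p x)))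

countBelow-+ : (p : ℕ → Bool) (m n : ℕ) → countBelow p (m + n) ≡ countBelow p m + countBelow (p ∘ (m +_)) n
countBelow-+ p m n = begin
  count p (applyUpTo id (m + n))                          ≡⟨ cong (count p) (split id m) ⟩
  count p (upTo m ++ applyUpTo (m +_) n)                  ≡⟨ count-++ p (upTo m) _ ⟩
  countBelow p m + count p (applyUpTo (m +_) n)           ≡⟨ cong (λ xs → countBelow p m + count p xs) (map-upTo (m +_) n) ⟨
  countBelow p m + count p (map (m +_) (upTo n))          ≡⟨ cong (countBelow p m +_) (count-map p (m +_) (upTo n)) ⟩
  countBelow p m + countBelow (p ∘ (m +_)) n              ∎
  where
  open ≡-Reasoning
  split : (f : ℕ → ℕ) (k : ℕ) → applyUpTo f (k + n) ≡ applyUpTo f k ++ applyUpTo (λ i → f (k + i)) n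
  split f zero    = refl
  split f (suc k) = cong (f 0 ∷_) (split (f ∘ suc) k)

countBelow-suc : (p : ℕ → Bool) (n : ℕ) → countBelow p (suc n) ≡ countBelow p n + bit (p n)
countBelow-suc p n = begin
  countBelow p (suc n)                            ≡⟨ cong (countBelow p) (+-comm 1 n) ⟩
  countBelow p (n + 1)                            ≡⟨ countBelow-+ p n 1 ⟩
  countBelow p n + countBelow (p ∘ (n +_)) 1      ≡⟨ cong (countBelow p n +_) (count-∷ (p ∘ (n +_)) 0 []) ⟩
  countBelow p n + (bit (p (n + 0)) + 0)          ≡⟨ cong (countBelow p n +_) (trans (+-identityʳ _) (cong (bit ∘ p) (+-identityʳ n))) ⟩
  countBelow p n + bit (p n)                      ∎
  where open ≡-Reasoning

countBelow-cong : {p q : ℕ → Bool} (n : ℕ) → (∀ i → i < n → p i ≡ q i) → countBelow p n ≡ countBelow q n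
countBelow-cong n p≡q = count-cong (upTo n) (λ i i∈ → p≡q i (∈-upTo⁻ i∈))

countBelow≤ : (p : ℕ → Bool) (n : ℕ) → countBelow p n ≤ n
countBelow≤ p n = ≤-trans (count≤length p (upTo n)) (≤-reflexive (length-upTo n))

-- Words, and the windows of a de Bruijn sequence.

words : ℕ → ℕ → List (List ℕ)
words b zero    = [] ∷ []
words b (suc r) = cartesianProductWith _∷_ (upTo b) (words b r)

words-unique : ∀ b r → Unique (words b r)
words-unique b zero    = [] ∷ []
words-unique b (suc r) = Unique.cartesianProductWith⁺ _∷_ ∷-injective (Unique.upTo⁺ b) (words-unique b r)

∈-words⁺ : ∀ {b} w → Word b w → w ∈ words b (length w)
∈-words⁺ []      []            = here refl
∈-words⁺ (x ∷ w) (x<b ∷ w-word) = ∈-cartesianProductWith⁺ _∷_ (∈-upTo⁺ x<b) (∈-words⁺ w w-word)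

∈-words⁻ : ∀ {b} r {w} → w ∈ words b r → length w ≡ r × Word b w
∈-words⁻ zero    (here refl) = refl , []
∈-words⁻ {b} (suc r) w∈ with ∈-cartesianProductWith⁻ _∷_ (upTo b) (words b r) w∈
... | x , w , x∈ , w∈′ , refl with ∈-words⁻ r w∈′
... | len , word = cong suc len , ∈-upTo⁻ x∈ ∷ word

length-words : ∀ b r → length (words b r) ≡ b ^ r
length-words b zero    = refl
length-words b (suc r) = begin
  length (words b (suc r))                        ≡⟨ count-true (words b (suc r)) ⟨
  count (λ _ → true) (words b (suc r))            ≡⟨ count-cartesianProductWith _∷_ (λ _ → true) (λ _ → true) (λ _ → true) (λ _ _ → refl) (upTo b) (words b r) ⟩
  count (λ _ → true) (upTo b) * count (λ _ → true) (words b r) ≡⟨ cong₂ _*_ (count-true (upTo b)) (count-true (words b r)) ⟩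
  length (upTo b) * length (words b r)            ≡⟨ cong₂ _*_ (length-upTo b) (length-words b r) ⟩
  b * b ^ r                                       ∎
  where open ≡-Reasoning

at-< : ∀ {b} s → Word b s → ∀ i → i < length s → at s i < b
at-< (x ∷ s) (x<b ∷ _) zero    _         = x<b
at-< (x ∷ s) (_ ∷ w)   (suc i) (s≤s i<n) = at-< s w i i<n

at-applyUpTo : ∀ (f : ℕ → ℕ) n i → i < n → at (applyUpTo f n) i ≡ f i
at-applyUpTo f (suc n) zero    _         = refl
at-applyUpTo f (suc n) (suc i) (s≤s i<n) = at-applyUpTo (f ∘ suc) n i i<n

All-applyUpTo : ∀ {P : ℕ → Set} (f : ℕ → ℕ) n → (∀ i → P (f i)) → All P (applyUpTo f n)
All-applyUpTo f zero    Pf = []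
All-applyUpTo f (suc n) Pf = Pf 0 ∷ All-applyUpTo (f ∘ suc) n (Pf ∘ suc)

cyclicWindow-applyUpTo : ∀ s i k .{{_ : NonZero (length s)}} →
                         cyclicWindow s i k ≡ applyUpTo (λ j → at s ((i + j) % length s)) k
cyclicWindow-applyUpTo s i k with length s
... | suc len = map-upTo _ k

-- Two duplicate-free lists with the same members are permutations of each other. The uniqueness
-- half of `IsDeBruijn` makes the windows distinct, and the existence half makes every word a
-- window.
windows-↭ : ∀ {b k s} .{{_ : NonZero (length s)}} → IsDeBruijn b k s →
            applyUpTo (λ i → cyclicWindow s i k) (b ^ k) ↭ words b k
windows-↭ {b} {k} {s} (_ , word , once) = ∼bag⇒↭ (unique∧set⇒bag
  (Unique.applyUpTo⁺₁ window (b ^ k) distinct) (words-unique b k) (mk⇔ to from))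
  where
  window : ℕ → List ℕ
  window i = cyclicWindow s i k
  window-length : ∀ i → length (window i) ≡ k
  window-length i = trans (cong length (cyclicWindow-applyUpTo s i k)) (length-applyUpTo _ k)
  window-word : ∀ i → Word b (window i)
  window-word i = subst (Word b) (sym (cyclicWindow-applyUpTo s i k))
    (All-applyUpTo _ k (λ j → at-< s word _ (m%n<n (i + j) (length s))))
  distinct : ∀ {i j} → i < j → j < b ^ k → window i ≢ window j
  distinct {i} {j} i<j j<n eq = <⇒≢ i<j
    (proj₂ (once (window j) (window-length j) (window-word j)) i j (<-trans i<j j<n) j<n eq refl)
  to : ∀ {w} → w ∈ applyUpTo window (b ^ k) → w ∈ words b k
  to w∈ with ∈-applyUpTo⁻ window w∈
  ... | i , _ , refl = subst (λ r → window i ∈ words b r) (window-length i) (∈-words⁺ (window i) (window-word i))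
  from : ∀ {w} → w ∈ words b k → w ∈ applyUpTo window (b ^ k)
  from {w} w∈ with ∈-words⁻ k w∈
  ... | len , w-word with proj₁ (once w len w-word)
  ... | i , i<n , refl = ∈-applyUpTo⁺ window i<n

countBelow-windows : ∀ {b k s} .{{_ : NonZero (length s)}} → IsDeBruijn b k s → (p : List ℕ → Bool) →
                     countBelow (λ i → p (cyclicWindow s i k)) (b ^ k) ≡ count p (words b k)
countBelow-windows {b} {k} {s} db p = begin
  countBelow (λ i → p (cyclicWindow s i k)) (b ^ k)            ≡⟨ count-map p (λ i → cyclicWindow s i k) (upTo (b ^ k)) ⟨
  count p (map (λ i → cyclicWindow s i k) (upTo (b ^ k)))      ≡⟨ cong (count p) (map-upTo (λ i → cyclicWindow s i k) (b ^ k)) ⟩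
  count p (applyUpTo (λ i → cyclicWindow s i k) (b ^ k))       ≡⟨ count-↭ p (windows-↭ db) ⟩
  count p (words b k)                                          ∎
  where open ≡-Reasoning

-- Clearing denominators.

fromℕ : ℕ → ℚ
fromℕ n = ℤ.+ n ℚ./ 1

toℚᵘ-fromℕ : ∀ n → toℚᵘ (fromℕ n) ℚᵘ.≃ ℚᵘ.mkℚᵘ (ℤ.+ n) 0
toℚᵘ-fromℕ n = ℚ.toℚᵘ-fromℚᵘ (ℚᵘ.mkℚᵘ (ℤ.+ n) 0)

fromℕ-* : ∀ m n → fromℕ (m * n) ≡ fromℕ m ℚ.* fromℕ n
fromℕ-* m n = ℚ.toℚᵘ-injective (begin
  toℚᵘ (fromℕ (m * n))                         ≈⟨ toℚᵘ-fromℕ (m * n) ⟩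
  ℚᵘ.mkℚᵘ (ℤ.+ (m * n)) 0                        ≈⟨ ℚᵘ.*≡* (cong (ℤ._* ℤ.+ 1) (ℤ.pos-* m n)) ⟩
  ℚᵘ.mkℚᵘ (ℤ.+ m) 0 ℚᵘ.* ℚᵘ.mkℚᵘ (ℤ.+ n) 0         ≈⟨ ℚᵘ.*-cong (toℚᵘ-fromℕ m) (toℚᵘ-fromℕ n) ⟨
  toℚᵘ (fromℕ m) ℚᵘ.* toℚᵘ (fromℕ n)           ≈⟨ ℚ.toℚᵘ-homo-* (fromℕ m) (fromℕ n) ⟨
  toℚᵘ (fromℕ m ℚ.* fromℕ n)                   ∎)
  where open ℚᵘ.≃-Reasoning

fromℕ-+ : ∀ m n → fromℕ (m + n) ≡ fromℕ m ℚ.+ fromℕ n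
fromℕ-+ m n = ℚ.toℚᵘ-injective (begin
  toℚᵘ (fromℕ (m + n))                         ≈⟨ toℚᵘ-fromℕ (m + n) ⟩
  ℚᵘ.mkℚᵘ (ℤ.+ (m + n)) 0                        ≈⟨ ℚᵘ.*≡* (cong (ℤ._* ℤ.+ 1) (cong₂ ℤ._+_ (sym (ℤ.*-identityʳ (ℤ.+ m))) (sym (ℤ.*-identityʳ (ℤ.+ n))))) ⟩
  ℚᵘ.mkℚᵘ (ℤ.+ m) 0 ℚᵘ.+ ℚᵘ.mkℚᵘ (ℤ.+ n) 0         ≈⟨ ℚᵘ.+-cong (toℚᵘ-fromℕ m) (toℚᵘ-fromℕ n) ⟨
  toℚᵘ (fromℕ m) ℚᵘ.+ toℚᵘ (fromℕ n)           ≈⟨ ℚ.toℚᵘ-homo-+ (fromℕ m) (fromℕ n) ⟨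
  toℚᵘ (fromℕ m ℚ.+ fromℕ n)                   ∎)
  where open ℚᵘ.≃-Reasoning

fromℕ-mono-≤ : ∀ {m n} → m ≤ n → fromℕ m ℚ.≤ fromℕ n
fromℕ-mono-≤ {m} {n} m≤n = ℚ.toℚᵘ-cancel-≤ (begin
  toℚᵘ (fromℕ m)     ≃⟨ toℚᵘ-fromℕ m ⟩
  ℚᵘ.mkℚᵘ (ℤ.+ m) 0    ≤⟨ ℚᵘ.*≤* (ℤ.*-monoʳ-≤-nonNeg (ℤ.+ 1) (ℤ.+≤+ m≤n)) ⟩
  ℚᵘ.mkℚᵘ (ℤ.+ n) 0    ≃⟨ toℚᵘ-fromℕ n ⟨
  toℚᵘ (fromℕ n)     ∎)
  where open ℚᵘ.≤-Reasoning

fromℕ-mono-< : ∀ {m n} → m < n → fromℕ m ℚ.< fromℕ n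
fromℕ-mono-< {m} {n} m<n = ℚ.toℚᵘ-cancel-< (begin-strict
  toℚᵘ (fromℕ m)     ≃⟨ toℚᵘ-fromℕ m ⟩
  ℚᵘ.mkℚᵘ (ℤ.+ m) 0    <⟨ ℚᵘ.*<* (ℤ.*-monoʳ-<-pos (ℤ.+ 1) (ℤ.+<+ m<n)) ⟩
  ℚᵘ.mkℚᵘ (ℤ.+ n) 0    ≃⟨ toℚᵘ-fromℕ n ⟨
  toℚᵘ (fromℕ n)     ∎)
  where open ℚᵘ.≤-Reasoning

fromℕ-cancel-≤ : ∀ {m n} → fromℕ m ℚ.≤ fromℕ n → m ≤ n
fromℕ-cancel-≤ {m} {n} m≤n with m ℕ.≤? n
... | yes p = p
... | no ¬p = contradiction (ℚ.<-≤-trans (fromℕ-mono-< (≰⇒> ¬p)) m≤n) (ℚ.<-irrefl refl)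

fromℕ-cancel-< : ∀ {m n} → fromℕ m ℚ.< fromℕ n → m < n
fromℕ-cancel-< {m} {n} m<n with m ℕ.<? n
... | yes p = p
... | no ¬p = contradiction (ℚ.<-≤-trans m<n (fromℕ-mono-≤ (≮⇒≥ ¬p))) (ℚ.<-irrefl refl)

fromℕ-nonNeg : ∀ n → ℚ.NonNegative (fromℕ n)
fromℕ-nonNeg n = ℚ.nonNegative (fromℕ-mono-≤ {0} {n} z≤n)

fromℕ-pos : ∀ n .{{_ : NonZero n}} → ℚ.Positive (fromℕ n)
fromℕ-pos n@(suc _) = ℚ.positive (fromℕ-mono-< {0} {n} z<s)

/-*-fromℕ : ∀ i n .{{_ : NonZero n}} → (i ℚ./ n) ℚ.* fromℕ n ≡ i ℚ./ 1
/-*-fromℕ i n@(suc d) = ℚ.toℚᵘ-injective (begin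
  toℚᵘ (i ℚ./ n ℚ.* fromℕ n)                   ≈⟨ ℚ.toℚᵘ-homo-* (i ℚ./ n) (fromℕ n) ⟩
  toℚᵘ (i ℚ./ n) ℚᵘ.* toℚᵘ (fromℕ n)           ≈⟨ ℚᵘ.*-cong (ℚ.toℚᵘ-fromℚᵘ (ℚᵘ.mkℚᵘ i d)) (toℚᵘ-fromℕ n) ⟩
  ℚᵘ.mkℚᵘ i d ℚᵘ.* ℚᵘ.mkℚᵘ (ℤ.+ n) 0             ≈⟨ ℚᵘ.*≡* (trans (ℤ.*-assoc i (ℤ.+ n) (ℤ.+ 1)) (cong (i ℤ.*_) (sym (ℤ.pos-* n 1)))) ⟩
  ℚᵘ.mkℚᵘ i 0                                  ≈⟨ ℚ.toℚᵘ-fromℚᵘ (ℚᵘ.mkℚᵘ i 0) ⟨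
  toℚᵘ (i ℚ./ 1)                               ∎)
  where open ℚᵘ.≃-Reasoning

frac-*-fromℕ : ∀ m n .{{_ : NonZero n}} → frac m n ℚ.* fromℕ n ≡ fromℕ m
frac-*-fromℕ m n@(suc _) = /-*-fromℕ (ℤ.+ m) n

numerator : ∀ p → 0ℚ ℚ.≤ p → ∃ λ a → p ℚ.* fromℕ (↧ₙ p) ≡ fromℕ a
numerator p@(ℚ.mkℚ (ℤ.+ a) _ _) _ = a , (begin
  p ℚ.* fromℕ (↧ₙ p)                  ≡⟨ cong (ℚ._* fromℕ (↧ₙ p)) (ℚ.↥p/↧p≡p p) ⟨
  (↥ p ℚ./ ↧ₙ p) ℚ.* fromℕ (↧ₙ p)     ≡⟨ /-*-fromℕ (↥ p) (↧ₙ p) ⟩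
  fromℕ a                             ∎)
  where open ≡-Reasoning
numerator (ℚ.mkℚ ℤ.-[1+ a ] _ _) (ℚ.*≤* ())

-- Multiplying by `q * n` turns a comparison of `p` with `m / n` into one of `a * n` with `q * m`.
-- The fraction `a / q` need not be in lowest terms, since both endpoints of an interval are to be
-- written over a common denominator.
module _ (p : ℚ) (a q m n : ℕ) .{{_ : NonZero q}} .{{_ : NonZero n}} (p*q≡a : p ℚ.* fromℕ q ≡ fromℕ a) where
  private
    s : ℕ
    s = q * n

    instance
      s-pos : ℚ.Positive (fromℕ s)
      s-pos = fromℕ-pos s {{m*n≢0 q n}}
      s-nonNeg : ℚ.NonNegative (fromℕ s)
      s-nonNeg = fromℕ-nonNeg s

    p*s : p ℚ.* fromℕ s ≡ fromℕ (a * n)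
    p*s = begin
      p ℚ.* fromℕ (q * n)             ≡⟨ cong (p ℚ.*_) (fromℕ-* q n) ⟩
      p ℚ.* (fromℕ q ℚ.* fromℕ n)     ≡⟨ ℚ.*-assoc p (fromℕ q) (fromℕ n) ⟨
      p ℚ.* fromℕ q ℚ.* fromℕ n       ≡⟨ cong (ℚ._* fromℕ n) p*q≡a ⟩
      fromℕ a ℚ.* fromℕ n             ≡⟨ fromℕ-* a n ⟨
      fromℕ (a * n)                   ∎
      where open ≡-Reasoning

    frac*s : frac m n ℚ.* fromℕ s ≡ fromℕ (q * m)
    frac*s = begin
      frac m n ℚ.* fromℕ (q * n)             ≡⟨ cong (λ r → frac m n ℚ.* fromℕ r) (*-comm q n) ⟩
      frac m n ℚ.* fromℕ (n * q)             ≡⟨ cong (frac m n ℚ.*_) (fromℕ-* n q) ⟩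
      frac m n ℚ.* (fromℕ n ℚ.* fromℕ q)     ≡⟨ ℚ.*-assoc (frac m n) (fromℕ n) (fromℕ q) ⟨
      frac m n ℚ.* fromℕ n ℚ.* fromℕ q       ≡⟨ cong (ℚ._* fromℕ q) (frac-*-fromℕ m n) ⟩
      fromℕ m ℚ.* fromℕ q                    ≡⟨ fromℕ-* m q ⟨
      fromℕ (m * q)                          ≡⟨ cong fromℕ (*-comm m q) ⟩
      fromℕ (q * m)                          ∎
      where open ≡-Reasoning

  ≤frac⇒ : p ℚ.≤ frac m n → a * n ≤ q * m
  ≤frac⇒ le = fromℕ-cancel-≤ (subst₂ ℚ._≤_ p*s frac*s (ℚ.*-monoʳ-≤-nonNeg (fromℕ s) le))

  ≤frac⇐ : a * n ≤ q * m → p ℚ.≤ frac m n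
  ≤frac⇐ le = ℚ.*-cancelʳ-≤-pos (fromℕ s) (subst₂ ℚ._≤_ (sym p*s) (sym frac*s) (fromℕ-mono-≤ le))

  frac<⇒ : frac m n ℚ.< p → q * m < a * n
  frac<⇒ lt = fromℕ-cancel-< (subst₂ ℚ._<_ frac*s p*s (ℚ.*-monoˡ-<-pos (fromℕ s) lt))

  frac<⇐ : q * m < a * n → frac m n ℚ.< p
  frac<⇐ lt = ℚ.*-cancelʳ-<-nonNeg (fromℕ s) (subst₂ ℚ._<_ (sym frac*s) (sym p*s) (fromℕ-mono-< lt))

  ⌊≤frac⌋ : ⌊ p ℚ.≤? frac m n ⌋ ≡ ⌊ a * n ℕ.≤? q * m ⌋
  ⌊≤frac⌋ = trans (isYes≗does (p ℚ.≤? frac m n)) (trans (does-⇔ (mk⇔ ≤frac⇒ ≤frac⇐) (p ℚ.≤? frac m n) (a * n ℕ.≤? q * m)) (sym (isYes≗does (a * n ℕ.≤? q * m))))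

  ⌊frac<⌋ : ⌊ frac m n ℚ.<? p ⌋ ≡ ⌊ q * m ℕ.<? a * n ⌋
  ⌊frac<⌋ = trans (isYes≗does (frac m n ℚ.<? p)) (trans (does-⇔ (mk⇔ frac<⇒ frac<⇐) (frac m n ℚ.<? p) (q * m ℕ.<? a * n)) (sym (isYes≗does (q * m ℕ.<? a * n))))

fromℕ-∸ : ∀ {m n} → n ≤ m → fromℕ m ℚ.- fromℕ n ≡ fromℕ (m ∸ n)
fromℕ-∸ {m} {n} n≤m = begin
  fromℕ m ℚ.- fromℕ n                           ≡⟨ cong (λ k → fromℕ k ℚ.- fromℕ n) (m∸n+n≡m n≤m) ⟨
  fromℕ (m ∸ n + n) ℚ.- fromℕ n                 ≡⟨ cong (ℚ._- fromℕ n) (fromℕ-+ (m ∸ n) n) ⟩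
  fromℕ (m ∸ n) ℚ.+ fromℕ n ℚ.- fromℕ n         ≡⟨ ℚ.+-assoc (fromℕ (m ∸ n)) (fromℕ n) (ℚ.- fromℕ n) ⟩
  fromℕ (m ∸ n) ℚ.+ (fromℕ n ℚ.- fromℕ n)       ≡⟨ cong (fromℕ (m ∸ n) ℚ.+_) (ℚ.+-inverseʳ (fromℕ n)) ⟩
  fromℕ (m ∸ n) ℚ.+ 0ℚ                          ≡⟨ ℚ.+-identityʳ (fromℕ (m ∸ n)) ⟩
  fromℕ (m ∸ n)                                 ∎
  where open ≡-Reasoning

∣p-q∣≡∣q-p∣ : ∀ p q → ℚ.∣ p ℚ.- q ∣ ≡ ℚ.∣ q ℚ.- p ∣
∣p-q∣≡∣q-p∣ p q = trans (sym (ℚ.∣-p∣≡∣p∣ (p ℚ.- q))) (cong ℚ.∣_∣ (⁻¹-anti-homo-// ℚ.+-0-group p q))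

fromℕ-∣-∣ : ∀ m n → ℚ.∣ fromℕ m ℚ.- fromℕ n ∣ ≡ fromℕ ∣ m - n ∣
fromℕ-∣-∣ m n with ≤-total n m
... | inj₁ n≤m = begin
  ℚ.∣ fromℕ m ℚ.- fromℕ n ∣   ≡⟨ cong ℚ.∣_∣ (fromℕ-∸ n≤m) ⟩
  ℚ.∣ fromℕ (m ∸ n) ∣         ≡⟨ ℚ.0≤p⇒∣p∣≡p (fromℕ-mono-≤ {0} {m ∸ n} z≤n) ⟩
  fromℕ (m ∸ n)               ≡⟨ cong fromℕ (m≤n⇒∣n-m∣≡n∸m n≤m) ⟨
  fromℕ ∣ m - n ∣             ∎
  where open ≡-Reasoning
... | inj₂ m≤n = begin
  ℚ.∣ fromℕ m ℚ.- fromℕ n ∣   ≡⟨ ∣p-q∣≡∣q-p∣ (fromℕ m) (fromℕ n) ⟩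
  ℚ.∣ fromℕ n ℚ.- fromℕ m ∣   ≡⟨ cong ℚ.∣_∣ (fromℕ-∸ m≤n) ⟩
  ℚ.∣ fromℕ (n ∸ m) ∣         ≡⟨ ℚ.0≤p⇒∣p∣≡p (fromℕ-mono-≤ {0} {n ∸ m} z≤n) ⟩
  fromℕ (n ∸ m)               ≡⟨ cong fromℕ (m≤n⇒∣m-n∣≡n∸m m≤n) ⟨
  fromℕ ∣ m - n ∣             ∎
  where open ≡-Reasoning

-- With `p = W / Q`, the deviation of `c / N` from `p` is a fraction over `Q * N`; its numerator is
-- the quantity later called `disc`.
∣frac-p∣-*-fromℕ : ∀ {p} c N Q W .{{_ : NonZero N}} → p ℚ.* fromℕ Q ≡ fromℕ W →
                   ℚ.∣ frac c N ℚ.- p ∣ ℚ.* fromℕ (Q * N) ≡ fromℕ ∣ Q * c - W * N ∣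
∣frac-p∣-*-fromℕ {p} c N Q W p*Q≡W = begin
  ℚ.∣ frac c N ℚ.- p ∣ ℚ.* fromℕ (Q * N)                        ≡⟨ cong (ℚ.∣ frac c N ℚ.- p ∣ ℚ.*_) (ℚ.0≤p⇒∣p∣≡p (fromℕ-mono-≤ {0} {Q * N} z≤n)) ⟨
  ℚ.∣ frac c N ℚ.- p ∣ ℚ.* ℚ.∣ fromℕ (Q * N) ∣                  ≡⟨ ℚ.∣p*q∣≡∣p∣*∣q∣ (frac c N ℚ.- p) (fromℕ (Q * N)) ⟨
  ℚ.∣ (frac c N ℚ.- p) ℚ.* fromℕ (Q * N) ∣                      ≡⟨ cong (λ r → ℚ.∣ (frac c N ℚ.- p) ℚ.* r ∣) (fromℕ-* Q N) ⟩
  ℚ.∣ (frac c N ℚ.- p) ℚ.* (fromℕ Q ℚ.* fromℕ N) ∣              ≡⟨ cong ℚ.∣_∣ (expand (frac c N) p (fromℕ Q) (fromℕ N)) ⟩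
  ℚ.∣ fromℕ Q ℚ.* (frac c N ℚ.* fromℕ N) ℚ.- p ℚ.* fromℕ Q ℚ.* fromℕ N ∣
    ≡⟨ cong₂ (λ x y → ℚ.∣ fromℕ Q ℚ.* x ℚ.- y ℚ.* fromℕ N ∣) (frac-*-fromℕ c N) p*Q≡W ⟩
  ℚ.∣ fromℕ Q ℚ.* fromℕ c ℚ.- fromℕ W ℚ.* fromℕ N ∣             ≡⟨ cong₂ (λ x y → ℚ.∣ x ℚ.- y ∣) (fromℕ-* Q c) (fromℕ-* W N) ⟨
  ℚ.∣ fromℕ (Q * c) ℚ.- fromℕ (W * N) ∣                         ≡⟨ fromℕ-∣-∣ (Q * c) (W * N) ⟩
  fromℕ ∣ Q * c - W * N ∣                                       ∎
  where
  open ≡-Reasoning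
  expand : ∀ x y q n → (x ℚ.- y) ℚ.* (q ℚ.* n) ≡ q ℚ.* (x ℚ.* n) ℚ.- y ℚ.* q ℚ.* n
  expand = solve 4 (λ x y q n → (x :- y) :* (q :* n) := q :* (x :* n) :- y :* q :* n) refl
    where open +-*-Solver

-- A positive `ε` has numerator at least 1, so it is enough to stay below `1 / ↧ₙ ε`.
∣frac-p∣<ε : ∀ {p ε} c N Q W .{{_ : NonZero N}} .{{_ : NonZero Q}} → p ℚ.* fromℕ Q ≡ fromℕ W →
             0ℚ ℚ.< ε → ∣ Q * c - W * N ∣ * ↧ₙ ε < Q * N → ℚ.∣ frac c N ℚ.- p ∣ ℚ.< ε
∣frac-p∣<ε {p} {ε} c N Q W p*Q≡W 0<ε bound with numerator ε (ℚ.<⇒≤ 0<ε)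
... | a , ε*d≡a = ℚ.*-cancelʳ-<-nonNeg (fromℕ d) {{fromℕ-nonNeg d}}
  (ℚ.*-cancelʳ-<-nonNeg (fromℕ (Q * N)) {{fromℕ-nonNeg (Q * N)}} (begin-strict
    ℚ.∣ frac c N ℚ.- p ∣ ℚ.* fromℕ d ℚ.* fromℕ (Q * N)     ≡⟨ swap ℚ.∣ frac c N ℚ.- p ∣ (fromℕ d) (fromℕ (Q * N)) ⟩
    ℚ.∣ frac c N ℚ.- p ∣ ℚ.* fromℕ (Q * N) ℚ.* fromℕ d     ≡⟨ cong (ℚ._* fromℕ d) (∣frac-p∣-*-fromℕ c N Q W p*Q≡W) ⟩
    fromℕ ∣ Q * c - W * N ∣ ℚ.* fromℕ d                    ≡⟨ fromℕ-* ∣ Q * c - W * N ∣ d ⟨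
    fromℕ (∣ Q * c - W * N ∣ * d)                          <⟨ fromℕ-mono-< bound ⟩
    fromℕ (Q * N)                                          ≤⟨ fromℕ-mono-≤ (m≤n*m (Q * N) a {{ℕ.>-nonZero 0<a}}) ⟩
    fromℕ (a * (Q * N))                                    ≡⟨ fromℕ-* a (Q * N) ⟩
    fromℕ a ℚ.* fromℕ (Q * N)                              ≡⟨ cong (ℚ._* fromℕ (Q * N)) ε*d≡a ⟨
    ε ℚ.* fromℕ d ℚ.* fromℕ (Q * N)                        ∎))
  where
  open ℚ.≤-Reasoning
  d : ℕ
  d = ↧ₙ ε
  swap : ∀ x y z → x ℚ.* y ℚ.* z ≡ x ℚ.* z ℚ.* y
  swap = solve 3 (λ x y z → x :* y :* z := x :* z :* y) refl
    where open +-*-Solver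
  0<a : 0 < a
  0<a = fromℕ-cancel-< (subst₂ ℚ._<_ (ℚ.*-zeroˡ (fromℕ d)) ε*d≡a (ℚ.*-monoˡ-<-pos (fromℕ d) {{fromℕ-pos d}} 0<ε))

frac<frac⇒ : ∀ {a b c d} .{{_ : NonZero b}} .{{_ : NonZero d}} → frac a b ℚ.< frac c d → d * a < c * b
frac<frac⇒ {a} {b} {c} {d} lt = frac<⇒ (frac c d) c d a b (frac-*-fromℕ c d) lt

-- Multiples of 1/n in an interval.

∣m-n∣≤o : ∀ {m n o} → m ≤ n + o → n ≤ m + o → ∣ m - n ∣ ≤ o
∣m-n∣≤o {m} {n} {o} m≤n+o n≤m+o with ≤-total m n
... | inj₁ m≤n = ≤-trans (≤-reflexive (m≤n⇒∣m-n∣≡n∸m m≤n)) (m≤n+o⇒m∸n≤o n m n≤m+o)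
... | inj₂ n≤m = ≤-trans (≤-reflexive (m≤n⇒∣n-m∣≡n∸m n≤m)) (m≤n+o⇒m∸n≤o m n m≤n+o)

module _ (q X : ℕ) where

  -- If the last index `n` is counted, then `q * n < X`, and the trivial bound `n + 1` on the count
  -- already suffices.
  countBelow-*< : ∀ n → q * countBelow (λ x → ⌊ q * x ℕ.<? X ⌋) n ≤ X + q
  countBelow-*< zero    = ≤-trans (≤-reflexive (*-zeroʳ q)) z≤n
  countBelow-*< (suc n) rewrite countBelow-suc (λ x → ⌊ q * x ℕ.<? X ⌋) n with q * n ℕ.<? X
  ... | no  _    = ≤-trans (≤-reflexive (cong (q *_) (+-identityʳ _))) (countBelow-*< n)
  ... | yes qn<X = begin
    q * (countBelow (λ x → ⌊ q * x ℕ.<? X ⌋) n + 1)   ≤⟨ *-monoʳ-≤ q (+-monoˡ-≤ 1 (countBelow≤ _ n)) ⟩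
    q * (n + 1)                                       ≡⟨ *-distribˡ-+ q n 1 ⟩
    q * n + q * 1                                     ≤⟨ +-mono-≤ (<⇒≤ qn<X) (≤-reflexive (*-identityʳ q)) ⟩
    X + q                                             ∎
    where open ≤-Reasoning

  ≤-countBelow-*< : ∀ n → X ≤ q * n → X ≤ q * countBelow (λ x → ⌊ q * x ℕ.<? X ⌋) n
  ≤-countBelow-*< n X≤qn with go n
    where
    -- Either the bound has been reached, or all indices so far are counted. The first failing index
    -- `n` gives `X ≤ q * n` with `n` indices counted before it.
    go : ∀ n → X ≤ q * countBelow (λ x → ⌊ q * x ℕ.<? X ⌋) n ⊎ n ≤ countBelow (λ x → ⌊ q * x ℕ.<? X ⌋) n
    go zero = inj₂ z≤n
    go (suc n) rewrite countBelow-suc (λ x → ⌊ q * x ℕ.<? X ⌋) n with go n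
    ... | inj₁ X≤ = inj₁ (≤-trans X≤ (*-monoʳ-≤ q (m≤m+n _ _)))
    ... | inj₂ n≤ with q * n ℕ.<? X
    ...   | yes _ = inj₂ (≤-trans (s≤s n≤) (≤-reflexive (+-comm 1 _)))
    ...   | no qn≮X = inj₁ (≤-trans (≮⇒≥ qn≮X) (*-monoʳ-≤ q (≤-trans n≤ (m≤m+n _ _))))
  ... | inj₁ X≤ = X≤
  ... | inj₂ n≤ = ≤-trans X≤qn (*-monoʳ-≤ q n≤)

-- Indicator form of the splitting of [0, Y) into [0, X) and [X, Y), which reduces intervals to
-- initial segments.
≤∧<-bits : ∀ {X Y} y → X ≤ Y → bit (⌊ X ℕ.≤? y ⌋ ∧ ⌊ y ℕ.<? Y ⌋) + bit ⌊ y ℕ.<? X ⌋ ≡ bit ⌊ y ℕ.<? Y ⌋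
≤∧<-bits {X} {Y} y X≤Y with X ℕ.≤? y | y ℕ.<? X
... | yes X≤y | yes y<X = contradiction X≤y (<⇒≱ y<X)
... | yes _   | no  _   = +-identityʳ _
... | no X≰y  | no y≮X  = contradiction (≰⇒> X≰y) y≮X
... | no _    | yes y<X with y ℕ.<? Y
...   | yes _  = refl
...   | no y≮Y = contradiction (<-≤-trans y<X X≤Y) y≮Y

-- The scaled counts `A` and `B` exceed `X` and `Y` by amounts between 0 and `q`. Both errors have
-- the same sign, so the difference `B - A` is off by at most `q` instead of `2 * q`.
interval-count : ∀ q {X Y n} → X ≤ Y → Y ≤ q * n →
  ∣ q * countBelow (λ x → ⌊ X ℕ.≤? q * x ⌋ ∧ ⌊ q * x ℕ.<? Y ⌋) n - (Y ∸ X) ∣ ≤ q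
interval-count q {X} {Y} {n} X≤Y Y≤qn = ∣m-n∣≤o
  (+-cancelʳ-≤ A (q * c) (Y ∸ X + q) (begin
    q * c + A             ≡⟨ split ⟩
    B                     ≤⟨ countBelow-*< q Y n ⟩
    Y + q                 ≡⟨ cong (_+ q) (m∸n+n≡m X≤Y) ⟨
    Y ∸ X + X + q         ≡⟨ swap (Y ∸ X) X q ⟩
    Y ∸ X + q + X         ≤⟨ +-monoʳ-≤ (Y ∸ X + q) (≤-countBelow-*< q X n (≤-trans X≤Y Y≤qn)) ⟩
    Y ∸ X + q + A         ∎))
  (+-cancelʳ-≤ X (Y ∸ X) (q * c + q) (begin
    Y ∸ X + X             ≡⟨ m∸n+n≡m X≤Y ⟩
    Y                     ≤⟨ ≤-countBelow-*< q Y n Y≤qn ⟩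
    B                     ≡⟨ split ⟨
    q * c + A             ≤⟨ +-monoʳ-≤ (q * c) (countBelow-*< q X n) ⟩
    q * c + (X + q)       ≡⟨ rotate (q * c) X q ⟩
    q * c + q + X         ∎))
  where
  open ≤-Reasoning
  c A B : ℕ
  c = countBelow (λ x → ⌊ X ℕ.≤? q * x ⌋ ∧ ⌊ q * x ℕ.<? Y ⌋) n
  A = q * countBelow (λ x → ⌊ q * x ℕ.<? X ⌋) n
  B = q * countBelow (λ x → ⌊ q * x ℕ.<? Y ⌋) n
  split : q * c + A ≡ B
  split = trans (sym (*-distribˡ-+ q c _)) (cong (q *_) (count-+ _ _ _ (upTo n) (λ x → ≤∧<-bits (q * x) X≤Y)))
  swap : ∀ a b c → a + b + c ≡ a + c + b
  swap = solve-∀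
  rotate : ∀ a b c → a + (b + c) ≡ a + c + b
  rotate = solve-∀

inInterval : ℚ → ℚ → ℕ → ℕ → Bool
inInterval u v n x = ⌊ u ℚ.≤? frac x n ⌋ ∧ ⌊ frac x n ℚ.<? v ⌋

-- The width of the interval is `w / q`, with a denominator independent of `n`. An error of `q` in
-- the scaled count means one point.
record IntervalEstimate (u v : ℚ) : Set where
  field
    q w      : ℕ
    q≢0      : NonZero q
    w≤q      : w ≤ q
    width    : (v ℚ.- u) ℚ.* fromℕ q ≡ fromℕ w
    estimate : ∀ n → .{{_ : NonZero n}} → ∣ q * countBelow (inInterval u v n) n - w * n ∣ ≤ q

interval-estimate : ∀ {u v} → 0ℚ ℚ.≤ u → u ℚ.≤ v → v ℚ.≤ 1ℚ → IntervalEstimate u v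
interval-estimate {u} {v} 0≤u u≤v v≤1 with numerator u 0≤u | numerator v (ℚ.≤-trans 0≤u u≤v)
... | a , u*≡a | b , v*≡b = record
  { q = q ; w = b′ ∸ a′ ; q≢0 = q≢0 ; w≤q = ≤-trans (m∸n≤m b′ a′) b′≤q ; width = width ; estimate = estimate }
  where
  q a′ b′ : ℕ
  q = ↧ₙ u * ↧ₙ v
  a′ = a * ↧ₙ v
  b′ = b * ↧ₙ u
  q≢0 : NonZero q
  q≢0 = m*n≢0 (↧ₙ u) (↧ₙ v)
  u*q≡a′ : u ℚ.* fromℕ q ≡ fromℕ a′
  u*q≡a′ = begin
    u ℚ.* fromℕ q                                    ≡⟨ cong (u ℚ.*_) (fromℕ-* (↧ₙ u) (↧ₙ v)) ⟩
    u ℚ.* (fromℕ (↧ₙ u) ℚ.* fromℕ (↧ₙ v))            ≡⟨ ℚ.*-assoc u (fromℕ (↧ₙ u)) (fromℕ (↧ₙ v)) ⟨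
    u ℚ.* fromℕ (↧ₙ u) ℚ.* fromℕ (↧ₙ v)              ≡⟨ cong (ℚ._* fromℕ (↧ₙ v)) u*≡a ⟩
    fromℕ a ℚ.* fromℕ (↧ₙ v)                         ≡⟨ fromℕ-* a (↧ₙ v) ⟨
    fromℕ a′                                         ∎
    where open ≡-Reasoning
  v*q≡b′ : v ℚ.* fromℕ q ≡ fromℕ b′
  v*q≡b′ = begin
    v ℚ.* fromℕ q                                    ≡⟨ cong (λ m → v ℚ.* fromℕ m) (*-comm (↧ₙ u) (↧ₙ v)) ⟩
    v ℚ.* fromℕ (↧ₙ v * ↧ₙ u)                        ≡⟨ cong (v ℚ.*_) (fromℕ-* (↧ₙ v) (↧ₙ u)) ⟩
    v ℚ.* (fromℕ (↧ₙ v) ℚ.* fromℕ (↧ₙ u))            ≡⟨ ℚ.*-assoc v (fromℕ (↧ₙ v)) (fromℕ (↧ₙ u)) ⟨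
    v ℚ.* fromℕ (↧ₙ v) ℚ.* fromℕ (↧ₙ u)              ≡⟨ cong (ℚ._* fromℕ (↧ₙ u)) v*≡b ⟩
    fromℕ b ℚ.* fromℕ (↧ₙ u)                         ≡⟨ fromℕ-* b (↧ₙ u) ⟨
    fromℕ b′                                         ∎
    where open ≡-Reasoning
  instance
    q-nonNeg : ℚ.NonNegative (fromℕ q)
    q-nonNeg = fromℕ-nonNeg q
  a′≤b′ : a′ ≤ b′
  a′≤b′ = fromℕ-cancel-≤ (subst₂ ℚ._≤_ u*q≡a′ v*q≡b′ (ℚ.*-monoʳ-≤-nonNeg (fromℕ q) u≤v))
  b′≤q : b′ ≤ q
  b′≤q = fromℕ-cancel-≤ (subst₂ ℚ._≤_ v*q≡b′ (ℚ.*-identityˡ (fromℕ q)) (ℚ.*-monoʳ-≤-nonNeg (fromℕ q) v≤1))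
  width : (v ℚ.- u) ℚ.* fromℕ q ≡ fromℕ (b′ ∸ a′)
  width = begin
    (v ℚ.- u) ℚ.* fromℕ q                            ≡⟨ expand v u (fromℕ q) ⟩
    v ℚ.* fromℕ q ℚ.- u ℚ.* fromℕ q                  ≡⟨ cong₂ ℚ._-_ v*q≡b′ u*q≡a′ ⟩
    fromℕ b′ ℚ.- fromℕ a′                            ≡⟨ fromℕ-∸ a′≤b′ ⟩
    fromℕ (b′ ∸ a′)                                  ∎
    where
    open ≡-Reasoning
    expand : ∀ x y z → (x ℚ.- y) ℚ.* z ≡ x ℚ.* z ℚ.- y ℚ.* z
    expand = solve 3 (λ x y z → (x :- y) :* z := x :* z :- y :* z) refl
      where open +-*-Solver
  estimate : ∀ n → .{{_ : NonZero n}} → ∣ q * countBelow (inInterval u v n) n - (b′ ∸ a′) * n ∣ ≤ q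
  estimate n = begin
    ∣ q * countBelow (inInterval u v n) n - (b′ ∸ a′) * n ∣
      ≡⟨ cong₂ (λ x y → ∣ q * x - y ∣) (countBelow-cong n same) (*-distribʳ-∸ n b′ a′) ⟩
    ∣ q * countBelow (λ x → ⌊ a′ * n ℕ.≤? q * x ⌋ ∧ ⌊ q * x ℕ.<? b′ * n ⌋) n - (b′ * n ∸ a′ * n) ∣
      ≤⟨ interval-count q (*-monoˡ-≤ n a′≤b′) (*-monoˡ-≤ n b′≤q) ⟩
    q ∎
    where
    open ≤-Reasoning
    same : ∀ x → x < n → inInterval u v n x ≡ ⌊ a′ * n ℕ.≤? q * x ⌋ ∧ ⌊ q * x ℕ.<? b′ * n ⌋
    same x _ = cong₂ _∧_ (⌊≤frac⌋ u a′ q x n {{q≢0}} u*q≡a′) (⌊frac<⌋ v b′ q x n {{q≢0}} v*q≡b′)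

-- Words in a box.

wordInBox : (k : ℕ) (u v : Fin k → ℚ) → ℕ → List ℕ → Bool
wordInBox k u v n w = inBox k u v (λ d → frac (at w (toℕ d)) n)

-- The factors are exchanged one at a time, through the middle term `w * n * (Q * C)`. The factor
-- left standing is at most `Q * X` or `q * n`, so relative errors add without a cross term: `1 / n`
-- from the new coordinate and `k / n` from the others.
∣*-*∣≤ : ∀ q w Q W n X c C → C ≤ X → w ≤ q → ∣ q * c - w * n ∣ ≤ q →
  ∀ k → ∣ Q * C - W * X ∣ * n ≤ k * (Q * X) →
  ∣ q * Q * (c * C) - w * W * (n * X) ∣ * n ≤ suc k * (q * Q * (n * X))
∣*-*∣≤ q w Q W n X c C C≤X w≤q one k many = begin
  ∣ q * Q * (c * C) - w * W * (n * X) ∣ * n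
    ≤⟨ *-monoˡ-≤ n (∣-∣-triangle (q * Q * (c * C)) (w * n * (Q * C)) (w * W * (n * X))) ⟩
  (∣ q * Q * (c * C) - w * n * (Q * C) ∣ + ∣ w * n * (Q * C) - w * W * (n * X) ∣) * n
    ≡⟨ cong (_* n) (cong₂ _+_ first second) ⟩
  (∣ q * c - w * n ∣ * (Q * C) + w * n * ∣ Q * C - W * X ∣) * n
    ≡⟨ regroup ∣ q * c - w * n ∣ (Q * C) w n ∣ Q * C - W * X ∣ ⟩
  ∣ q * c - w * n ∣ * (Q * C) * n + w * n * (∣ Q * C - W * X ∣ * n)
    ≤⟨ +-mono-≤ (*-monoˡ-≤ n (*-mono-≤ one (*-monoʳ-≤ Q C≤X))) (*-mono-≤ (*-monoˡ-≤ n w≤q) many) ⟩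
  q * (Q * X) * n + q * n * (k * (Q * X))
    ≡⟨ collect q Q X n k ⟩
  suc k * (q * Q * (n * X)) ∎
  where
  open ≤-Reasoning
  e₁ : ∀ q Q c C → q * Q * (c * C) ≡ q * c * (Q * C)
  e₁ = solve-∀
  e₂ : ∀ w W n X → w * W * (n * X) ≡ w * n * (W * X)
  e₂ = solve-∀
  first : ∣ q * Q * (c * C) - w * n * (Q * C) ∣ ≡ ∣ q * c - w * n ∣ * (Q * C)
  first = trans (cong (λ x → ∣ x - w * n * (Q * C) ∣) (e₁ q Q c C)) (sym (*-distribʳ-∣-∣ (Q * C) (q * c) (w * n)))
  second : ∣ w * n * (Q * C) - w * W * (n * X) ∣ ≡ w * n * ∣ Q * C - W * X ∣
  second = trans (cong (λ x → ∣ w * n * (Q * C) - x ∣) (e₂ w W n X)) (sym (*-distribˡ-∣-∣ (w * n) (Q * C) (W * X)))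
  regroup : ∀ a b w n d → (a * b + w * n * d) * n ≡ a * b * n + w * n * (d * n)
  regroup = solve-∀
  collect : ∀ q Q X n k → q * (Q * X) * n + q * n * (k * (Q * X)) ≡ (1 + k) * (q * Q * (n * X))
  collect = solve-∀

-- The volume is `W / Q`. The `r` letters after the first `k` are unconstrained; they are present
-- from the start because the windows that can be counted have length `n` and not `k`. The factor
-- `n` on the left expresses an error of `k / n` relative to all words.
record BoxEstimate (k : ℕ) (u v : Fin k → ℚ) : Set where
  field
    Q W      : ℕ
    Q≢0      : NonZero Q
    W≤Q      : W ≤ Q
    volume-Q : volume k u v ℚ.* fromℕ Q ≡ fromℕ W
    estimate : ∀ n r → .{{_ : NonZero n}} →
      ∣ Q * count (wordInBox k u v n) (words n (k + r)) - W * n ^ (k + r) ∣ * n ≤ k * (Q * n ^ (k + r))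

box-estimate-suc : ∀ k (u v : Fin (suc k) → ℚ) → IntervalEstimate (u Fin.zero) (v Fin.zero) →
  BoxEstimate k (u ∘ Fin.suc) (v ∘ Fin.suc) → BoxEstimate (suc k) u v
box-estimate-suc k u v I B = record
  { Q = q * Q ; W = w * W ; Q≢0 = m*n≢0 q Q {{q≢0}} {{Q≢0}} ; W≤Q = *-mono-≤ w≤q W≤Q
  ; volume-Q = volume′ ; estimate = estimate′ }
  where
  open IntervalEstimate I renaming (estimate to one)
  open BoxEstimate B renaming (estimate to many)
  volume′ : (v Fin.zero ℚ.- u Fin.zero) ℚ.* volume k (u ∘ Fin.suc) (v ∘ Fin.suc) ℚ.* fromℕ (q * Q) ≡ fromℕ (w * W)
  volume′ = begin
    x ℚ.* y ℚ.* fromℕ (q * Q)                    ≡⟨ cong (x ℚ.* y ℚ.*_) (fromℕ-* q Q) ⟩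
    x ℚ.* y ℚ.* (fromℕ q ℚ.* fromℕ Q)            ≡⟨ interchange x y (fromℕ q) (fromℕ Q) ⟩
    x ℚ.* fromℕ q ℚ.* (y ℚ.* fromℕ Q)            ≡⟨ cong₂ ℚ._*_ width volume-Q ⟩
    fromℕ w ℚ.* fromℕ W                          ≡⟨ fromℕ-* w W ⟨
    fromℕ (w * W)                                ∎
    where
    open ≡-Reasoning
    x y : ℚ
    x = v Fin.zero ℚ.- u Fin.zero
    y = volume k (u ∘ Fin.suc) (v ∘ Fin.suc)
    interchange : ∀ x y z t → x ℚ.* y ℚ.* (z ℚ.* t) ≡ x ℚ.* z ℚ.* (y ℚ.* t)
    interchange = solve 4 (λ x y z t → x :* y :* (z :* t) := x :* z :* (y :* t)) refl
      where open +-*-Solver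
  tail-count≤ : ∀ n r → count (wordInBox k (u ∘ Fin.suc) (v ∘ Fin.suc) n) (words n r) ≤ n ^ r
  tail-count≤ n r = ≤-trans (count≤length _ (words n r)) (≤-reflexive (length-words n r))
  count-suc : ∀ n r → count (wordInBox (suc k) u v n) (words n (suc r)) ≡
    countBelow (inInterval (u Fin.zero) (v Fin.zero) n) n * count (wordInBox k (u ∘ Fin.suc) (v ∘ Fin.suc) n) (words n r)
  count-suc n r = count-cartesianProductWith _∷_ (inInterval (u Fin.zero) (v Fin.zero) n)
    (wordInBox k (u ∘ Fin.suc) (v ∘ Fin.suc) n) (wordInBox (suc k) u v n)
    (λ a w′ → sym (∧-assoc ⌊ u Fin.zero ℚ.≤? frac a n ⌋ ⌊ frac a n ℚ.<? v Fin.zero ⌋ _)) (upTo n) (words n r)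
  estimate′ : ∀ n r → .{{_ : NonZero n}} →
    ∣ q * Q * count (wordInBox (suc k) u v n) (words n (suc k + r)) - w * W * n ^ (suc k + r) ∣ * n ≤
    suc k * (q * Q * n ^ (suc k + r))
  estimate′ n r = ≤-trans
    (≤-reflexive (cong (λ c → ∣ q * Q * c - w * W * (n * n ^ (k + r)) ∣ * n) (count-suc n (k + r))))
    (∣*-*∣≤ q w Q W n (n ^ (k + r)) (countBelow (inInterval (u Fin.zero) (v Fin.zero) n) n)
       (count (wordInBox k (u ∘ Fin.suc) (v ∘ Fin.suc) n) (words n (k + r)))
       (tail-count≤ n (k + r)) w≤q (one n) k (many n r))

box-estimate : ∀ k (u v : Fin k → ℚ) → IsBox k u v → BoxEstimate k u v
box-estimate zero u v _ = record
  { Q = 1 ; W = 1 ; W≤Q = ≤-refl ; volume-Q = refl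
  ; estimate = λ n r → ≤-reflexive (cong (_* n) (m≡n⇒∣m-n∣≡0 (cong (1 *_) (trans (count-true (words n r)) (length-words n r))))) }
box-estimate (suc k) u v box with box Fin.zero
... | 0≤u , u≤v , v≤1 =
  box-estimate-suc k u v (interval-estimate 0≤u u≤v v≤1) (box-estimate k (u ∘ Fin.suc) (v ∘ Fin.suc) (box ∘ Fin.suc))

-- The block structure of the sequence.

inBox-cong : ∀ k (u v : Fin k → ℚ) {x y : Fin k → ℚ} → (∀ d → x d ≡ y d) → inBox k u v x ≡ inBox k u v y
inBox-cong zero    u v x≡y = refl
inBox-cong (suc k) u v x≡y = cong₂ (λ a b → ⌊ u Fin.zero ℚ.≤? a ⌋ ∧ ⌊ a ℚ.<? v Fin.zero ⌋ ∧ b)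
  (x≡y Fin.zero) (inBox-cong k (u ∘ Fin.suc) (v ∘ Fin.suc) (x≡y ∘ Fin.suc))

at-cyclicWindow : ∀ s m k d .{{_ : NonZero (length s)}} → d < k →
                  at (cyclicWindow s (m % length s) k) d ≡ at s ((m + d) % length s)
at-cyclicWindow s m k d d<k = begin
  at (cyclicWindow s (m % ℓ) k) d                     ≡⟨ cong (λ w → at w d) (cyclicWindow-applyUpTo s (m % ℓ) k) ⟩
  at (applyUpTo (λ j → at s ((m % ℓ + j) % ℓ)) k) d   ≡⟨ at-applyUpTo _ k d d<k ⟩
  at s ((m % ℓ + d) % ℓ)                              ≡⟨ cong (at s) (%-distribˡ-+ (m % ℓ) d ℓ) ⟩
  at s ((m % ℓ % ℓ + d % ℓ) % ℓ)                      ≡⟨ cong (λ i → at s ((i + d % ℓ) % ℓ)) (m%n%n≡m%n m ℓ) ⟩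
  at s ((m % ℓ + d % ℓ) % ℓ)                          ≡⟨ cong (at s) (%-distribˡ-+ m d ℓ) ⟨
  at s ((m + d) % ℓ)                                  ∎
  where
  open ≡-Reasoning
  ℓ : ℕ
  ℓ = length s

module Blocks (F : ℕ → List ℕ) (t : ℕ → ℕ) where

  -- Blocks are indexed from 0 here: `j` stands for the block built from `F (suc j)`, and `start j`
  -- is its first position.
  start : ℕ → ℕ
  start zero    = 0
  start (suc j) = start j + t (suc j) * length (F (suc j))

  Lgo-here : ∀ f n m .{{_ : NonZero (length (F n))}} → m < t n * length (F n) →
             Lgo F t (suc f) n m ≡ frac (at (F n) (m % length (F n))) n
  Lgo-here f n m m<tℓ with length (F n)
  ... | suc len with m ℕ.<? t n * suc len
  ...   | yes _   = refl
  ...   | no m≮tℓ = contradiction m<tℓ m≮tℓ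

  Lgo-skip : ∀ f n m .{{_ : NonZero (length (F n))}} →
             Lgo F t (suc f) n (t n * length (F n) + m) ≡ Lgo F t f (suc n) m
  Lgo-skip f n m with length (F n)
  ... | suc len with t n * suc len + m ℕ.<? t n * suc len
  ...   | yes lt = contradiction (m≤m+n (t n * suc len) m) (<⇒≱ lt)
  ...   | no _   = cong (Lgo F t f (suc n)) (m+n∸m≡n (t n * suc len) m)

  module _ (F≢[] : ∀ n → 1 ≤ n → NonZero (length (F n))) (1≤t : ∀ n → 1 ≤ n → 1 ≤ t n) where
    private instance
      F-nonZero : ∀ {j} → NonZero (length (F (suc j)))
      F-nonZero {j} = F≢[] (suc j) (s≤s z≤n)

    -- Each skipped block costs one unit of fuel, hence the fuel `j + f`.
    Lgo-start : ∀ j f m → Lgo F t (j + f) 1 (start j + m) ≡ Lgo F t f (suc j) m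
    Lgo-start zero    f m = refl
    Lgo-start (suc j) f m = begin
      Lgo F t (suc j + f) 1 (start j + T + m)         ≡⟨ cong₂ (λ x y → Lgo F t x 1 y) (sym (+-suc j f)) (+-assoc (start j) T m) ⟩
      Lgo F t (j + suc f) 1 (start j + (T + m))       ≡⟨ Lgo-start j (suc f) (T + m) ⟩
      Lgo F t (suc f) (suc j) (T + m)                 ≡⟨ Lgo-skip f (suc j) m ⟩
      Lgo F t f (suc (suc j)) m                       ∎
      where
      open ≡-Reasoning
      T : ℕ
      T = t (suc j) * length (F (suc j))

    1≤block : ∀ j → 1 ≤ t (suc j) * length (F (suc j))
    1≤block j = *-mono-≤ (1≤t (suc j) (s≤s z≤n)) (ℕ.>-nonZero⁻¹ (length (F (suc j))))

    -- Ensures that the fuel in `L` suffices: a position in block `j` is at least `j`, so fuel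
    -- remains after `j` skips.
    ≤start : ∀ j → j ≤ start j
    ≤start zero    = z≤n
    ≤start (suc j) = ≤-trans (≤-reflexive (+-comm 1 j)) (+-mono-≤ (≤start j) (1≤block j))

    L-block : ∀ j m → m < t (suc j) * length (F (suc j)) →
              L F t (start j + m) ≡ frac (at (F (suc j)) (m % length (F (suc j)))) (suc j)
    L-block j m m<T = begin
      Lgo F t (suc (start j + m)) 1 (start j + m)             ≡⟨ cong (λ f → Lgo F t f 1 (start j + m)) fuel ⟩
      Lgo F t (j + suc (start j + m ∸ j)) 1 (start j + m)     ≡⟨ Lgo-start j (suc (start j + m ∸ j)) m ⟩
      Lgo F t (suc (start j + m ∸ j)) (suc j) m               ≡⟨ Lgo-here (start j + m ∸ j) (suc j) m m<T ⟩
      frac (at (F (suc j)) (m % length (F (suc j)))) (suc j)  ∎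
      where
      open ≡-Reasoning
      fuel : suc (start j + m) ≡ j + suc (start j + m ∸ j)
      fuel = sym (trans (+-suc j _) (cong suc (m+[n∸m]≡n (≤-trans (≤start j) (m≤m+n (start j) m)))))

    -- The bound on `m + k` keeps the window inside one block, where the sequence is periodic, so
    -- wrapping around a cycle is harmless. The cyclic window on the right has the full length
    -- `suc j`, the only length about which the de Bruijn property speaks; `wordInBox k` reads its
    -- first `k` letters.
    inBox-L : ∀ {k} (u v : Fin k → ℚ) j m → k ≤ suc j → m + k ≤ t (suc j) * length (F (suc j)) →
      inBox k u v (λ d → L F t (start j + m + toℕ d)) ≡
      wordInBox k u v (suc j) (cyclicWindow (F (suc j)) (m % length (F (suc j))) (suc j))
    inBox-L {k} u v j m k≤n m+k≤T = inBox-cong k u v λ d → begin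
      L F t (start j + m + toℕ d)      ≡⟨ cong (L F t) (+-assoc (start j) m (toℕ d)) ⟩
      L F t (start j + (m + toℕ d))    ≡⟨ L-block j (m + toℕ d) (<-≤-trans (+-monoʳ-< m (Fin.toℕ<n d)) m+k≤T) ⟩
      frac (at (F (suc j)) ((m + toℕ d) % length (F (suc j)))) (suc j)
        ≡⟨ cong (λ a → frac a (suc j)) (at-cyclicWindow (F (suc j)) m (suc j) (toℕ d) (<-≤-trans (Fin.toℕ<n d) k≤n)) ⟨
      frac (at (cyclicWindow (F (suc j)) (m % length (F (suc j))) (suc j)) (toℕ d)) (suc j) ∎
      where open ≡-Reasoning

    -- Advancing by one position either stays in the block or enters the next, nonempty one.
    -- Starting from block `j` yields an index of the form `j + i`, so the lower bound on the block
    -- comes for free.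
    locate : ∀ j d → ∃₂ λ i m → m < t (suc (j + i)) * length (F (suc (j + i))) × start j + d ≡ start (j + i) + m
    locate j zero = 0 , 0 , 1≤block (j + 0) , cong (λ i → start i + 0) (sym (+-identityʳ j))
    locate j (suc d) with locate j d
    ... | i , m , m<T , eq with m≤n⇒m<n∨m≡n m<T
    ...   | inj₁ 1+m<T = i , suc m , 1+m<T , trans (+-suc (start j) d) (trans (cong suc eq) (sym (+-suc _ m)))
    ...   | inj₂ 1+m≡T = suc i , 0 , 1≤block (j + suc i) , (begin
      start j + suc d                                              ≡⟨ trans (+-suc (start j) d) (cong suc eq) ⟩
      suc (start (j + i) + m)                                      ≡⟨ +-suc (start (j + i)) m ⟨
      start (j + i) + suc m                                        ≡⟨ cong (start (j + i) +_) 1+m≡T ⟩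
      start (suc (j + i))                                          ≡⟨ cong start (+-suc j i) ⟨
      start (j + suc i)                                            ≡⟨ +-identityʳ _ ⟨
      start (j + suc i) + 0                                        ∎)
      where open ≡-Reasoning

-- Discrepancy over ranges, cycles and blocks.

module Discrepancy (Q W : ℕ) (W≤Q : W ≤ Q) where

  -- The distance of the count from its expected value `W * l / Q`, scaled by `Q`.
  disc : (ℕ → Bool) → ℕ → ℕ
  disc e l = ∣ Q * countBelow e l - W * l ∣

  -- This subadditivity is what permits cutting a range into pieces of different quality.
  disc-+ : ∀ e m l → disc e (m + l) ≤ disc e m + disc (e ∘ (m +_)) l
  disc-+ e m l = begin
    ∣ Q * countBelow e (m + l) - W * (m + l) ∣
      ≡⟨ cong₂ ∣_-_∣ (trans (cong (Q *_) (countBelow-+ e m l)) (*-distribˡ-+ Q (countBelow e m) c)) (*-distribˡ-+ W m l) ⟩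
    ∣ Q * countBelow e m + Q * c - W * m + W * l ∣
      ≤⟨ ∣-∣-triangle (Q * countBelow e m + Q * c) (W * m + Q * c) (W * m + W * l) ⟩
    ∣ Q * countBelow e m + Q * c - W * m + Q * c ∣ + ∣ W * m + Q * c - W * m + W * l ∣
      ≡⟨ cong₂ _+_ (cancelʳ (Q * countBelow e m) (W * m) (Q * c)) (∣m+n-m+o∣≡∣n-o∣ (W * m) (Q * c) (W * l)) ⟩
    disc e m + disc (e ∘ (m +_)) l ∎
    where
    open ≤-Reasoning hiding (start)
    c : ℕ
    c = countBelow (e ∘ (m +_)) l
    cancelʳ : ∀ a b c → ∣ a + c - b + c ∣ ≡ ∣ a - b ∣
    cancelʳ a b c = trans (cong₂ ∣_-_∣ (+-comm a c) (+-comm b c)) (∣m+n-m+o∣≡∣n-o∣ c a b)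

  -- Both `Q * countBelow e l` and `W * l` lie between 0 and `Q * l`.
  disc≤ : ∀ e l → disc e l ≤ Q * l
  disc≤ e l = ∣m-n∣≤o
    (≤-trans (*-monoʳ-≤ Q (countBelow≤ e l)) (m≤n+m (Q * l) (W * l)))
    (≤-trans (*-monoˡ-≤ l W≤Q) (m≤n+m (Q * l) (Q * countBelow e l)))

  disc-cong : ∀ {e g} l → (∀ i → i < l → e i ≡ g i) → disc e l ≡ disc g l
  disc-cong l e≡g = cong (λ c → ∣ Q * c - W * l ∣) (countBelow-cong l e≡g)

  disc-periodic : ∀ e g ℓ .{{_ : NonZero ℓ}} c → (∀ i → i < c * ℓ → e i ≡ g (i % ℓ)) →
                  disc e (c * ℓ) ≤ c * disc g ℓ
  disc-periodic e g ℓ zero    _   = ≤-reflexive (trans (∣-∣-comm (Q * 0) (W * 0)) (cong₂ ∣_-_∣ (*-zeroʳ W) (*-zeroʳ Q)))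
  disc-periodic e g ℓ (suc c) e≡g = ≤-trans (disc-+ e ℓ (c * ℓ)) (+-mono-≤
    (≤-reflexive (disc-cong ℓ (λ i i<ℓ → trans (e≡g i (<-≤-trans i<ℓ (m≤m+n ℓ (c * ℓ)))) (cong g (m<n⇒m%n≡m i<ℓ)))))
    (disc-periodic (e ∘ (ℓ +_)) g ℓ c (λ i i<cℓ → trans (e≡g (ℓ + i) (+-monoʳ-< ℓ i<cℓ))
      (cong g (trans (cong (_% ℓ) (+-comm ℓ i)) ([m+n]%n≡m%n i ℓ))))))

  -- Block j consists of b j cycles of length ℓ j.  Only the last cycle of a
  -- block can be badly distributed, since its windows reach into the next block.
  module _ (e : ℕ → Bool) (K M : ℕ) (b ℓ start : ℕ → ℕ)
    (ℓ≢0 : ∀ j → NonZero (ℓ j))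
    (start-suc : ∀ j → start (suc j) ≡ start j + b j * ℓ j)
    (cycles : ∀ j c → M ≤ j → suc c ≤ b j → K * disc (e ∘ (start j +_)) (c * ℓ j) ≤ Q * (c * ℓ j))
    (K≤b : ∀ j → M ≤ j → K ≤ b j)
    (1≤b : ∀ j → 1 ≤ b j)
    (growth : ∀ j → M ≤ j → K * ℓ (suc j) ≤ 8 * (b j * ℓ j))
    where

    -- One unit of the constant 2 comes from the good cycles. The other pays for the last cycle: its
    -- trivial bound, multiplied by `K ≤ b j`, is at most `Q` times the length of the block.
    disc-block : ∀ j → M ≤ j → K * disc (e ∘ (start j +_)) (b j * ℓ j) ≤ 2 * (Q * (b j * ℓ j))
    disc-block j M≤j = go (b j) refl (1≤b j)
      where
      e′ : ℕ → Bool
      e′ = e ∘ (start j +_)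
      -- The number of cycles is generalised to a variable so that matching on `suc c` can split off
      -- the last one.
      go : ∀ x → x ≡ b j → 1 ≤ x → K * disc e′ (x * ℓ j) ≤ 2 * (Q * (x * ℓ j))
      go (suc c) eq _ = begin
        K * disc e′ (ℓ j + c * ℓ j)                              ≡⟨ cong (λ l → K * disc e′ l) (+-comm (ℓ j) (c * ℓ j)) ⟩
        K * disc e′ (c * ℓ j + ℓ j)                              ≤⟨ *-monoʳ-≤ K (disc-+ e′ (c * ℓ j) (ℓ j)) ⟩
        K * (disc e′ (c * ℓ j) + disc (e′ ∘ (c * ℓ j +_)) (ℓ j)) ≡⟨ *-distribˡ-+ K (disc e′ (c * ℓ j)) (disc (e′ ∘ (c * ℓ j +_)) (ℓ j)) ⟩
        K * disc e′ (c * ℓ j) + K * disc (e′ ∘ (c * ℓ j +_)) (ℓ j)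
          ≤⟨ +-mono-≤ (cycles j c M≤j (≤-reflexive eq)) (*-mono-≤ (≤-trans (K≤b j M≤j) (≤-reflexive (sym eq))) (disc≤ (e′ ∘ (c * ℓ j +_)) (ℓ j))) ⟩
        Q * (c * ℓ j) + suc c * (Q * ℓ j)                        ≤⟨ +-monoˡ-≤ (suc c * (Q * ℓ j)) (*-monoʳ-≤ Q (m≤n+m (c * ℓ j) (ℓ j))) ⟩
        Q * (suc c * ℓ j) + suc c * (Q * ℓ j)                    ≡⟨ collect Q (suc c) (ℓ j) ⟩
        2 * (Q * (suc c * ℓ j))                                  ∎
        where
        open ≤-Reasoning hiding (start)
        collect : ∀ q c l → q * (c * l) + c * (q * l) ≡ 2 * (q * (c * l))
        collect = solve-∀

    -- Nothing is known about the blocks before `M`; their trivial bound gives the first summand,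
    -- which does not depend on `i`.
    disc-start : ∀ i → K * disc e (start (M + i)) ≤ Q * (K * start M) + 2 * (Q * start (M + i))
    disc-start zero = begin
      K * disc e (start (M + 0))                             ≡⟨ cong (λ j → K * disc e (start j)) (+-identityʳ M) ⟩
      K * disc e (start M)                                   ≤⟨ *-monoʳ-≤ K (disc≤ e (start M)) ⟩
      K * (Q * start M)                                      ≡⟨ swap K Q (start M) ⟩
      Q * (K * start M)                                      ≤⟨ m≤m+n _ _ ⟩
      Q * (K * start M) + 2 * (Q * start (M + 0))            ∎
      where
      open ≤-Reasoning hiding (start)
      swap : ∀ a b c → a * (b * c) ≡ b * (a * c)
      swap = solve-∀
    disc-start (suc i) = begin
      K * disc e (start (M + suc i))                         ≡⟨ cong (λ l → K * disc e l) next ⟩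
      K * disc e (start j + T)                               ≤⟨ *-monoʳ-≤ K (disc-+ e (start j) T) ⟩
      K * (disc e (start j) + disc (e ∘ (start j +_)) T)     ≡⟨ *-distribˡ-+ K (disc e (start j)) (disc (e ∘ (start j +_)) T) ⟩
      K * disc e (start j) + K * disc (e ∘ (start j +_)) T   ≤⟨ +-mono-≤ (disc-start i) (disc-block j (m≤m+n M i)) ⟩
      Q * (K * start M) + 2 * (Q * start j) + 2 * (Q * T)    ≡⟨ collect (Q * (K * start M)) Q (start j) T ⟩
      Q * (K * start M) + 2 * (Q * (start j + T))            ≡⟨ cong (λ l → Q * (K * start M) + 2 * (Q * l)) next ⟨
      Q * (K * start M) + 2 * (Q * start (M + suc i))        ∎
      where
      open ≤-Reasoning hiding (start)
      j T : ℕ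
      j = M + i
      T = b j * ℓ j
      next : start (M + suc i) ≡ start j + T
      next = trans (cong start (+-suc M i)) (start-suc j)
      collect : ∀ a q s t → a + 2 * (q * s) + 2 * (q * t) ≡ a + 2 * (q * (s + t))
      collect = solve-∀

    -- Of the `m` positions, the complete cycles number fewer than `b (suc j)`, so none of them is
    -- the last of its block. The remainder is shorter than one cycle and is charged by `growth` to
    -- the preceding block, hence to `start (suc j)`; therefore the block has index `suc j`.
    disc-partial : ∀ j m → M ≤ j → m < b (suc j) * ℓ (suc j) →
                   K * disc (e ∘ (start (suc j) +_)) m ≤ Q * m + 8 * (Q * start (suc j))
    disc-partial j m M≤j m<T = begin
      K * disc e′ m                                        ≡⟨ cong (λ l → K * disc e′ l) m≡ ⟩
      K * disc e′ (c * l + r)                              ≤⟨ *-monoʳ-≤ K (disc-+ e′ (c * l) r) ⟩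
      K * (disc e′ (c * l) + disc (e′ ∘ (c * l +_)) r)     ≡⟨ *-distribˡ-+ K (disc e′ (c * l)) (disc (e′ ∘ (c * l +_)) r) ⟩
      K * disc e′ (c * l) + K * disc (e′ ∘ (c * l +_)) r
        ≤⟨ +-mono-≤ (cycles (suc j) c (m≤n⇒m≤1+n M≤j) (m<n*o⇒m/o<n m<T)) (*-monoʳ-≤ K (≤-trans (disc≤ (e′ ∘ (c * l +_)) r) (*-monoʳ-≤ Q (m%n≤n m l)))) ⟩
      Q * (c * l) + K * (Q * l)                            ≤⟨ +-monoˡ-≤ (K * (Q * l)) (*-monoʳ-≤ Q (≤-trans (m≤m+n (c * l) r) (≤-reflexive (sym m≡)))) ⟩
      Q * m + K * (Q * l)                                  ≡⟨ cong (Q * m +_) (swap K Q l) ⟩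
      Q * m + Q * (K * l)                                  ≤⟨ +-monoʳ-≤ (Q * m) (*-monoʳ-≤ Q (growth j M≤j)) ⟩
      Q * m + Q * (8 * (b j * ℓ j))                        ≤⟨ +-monoʳ-≤ (Q * m) (*-monoʳ-≤ Q (*-monoʳ-≤ 8 (≤-trans (m≤n+m (b j * ℓ j) (start j)) (≤-reflexive (sym (start-suc j)))))) ⟩
      Q * m + Q * (8 * start (suc j))                      ≡⟨ cong (Q * m +_) (swap Q 8 (start (suc j))) ⟩
      Q * m + 8 * (Q * start (suc j))                      ∎
      where
      open ≤-Reasoning hiding (start)
      e′ : ℕ → Bool
      e′ = e ∘ (start (suc j) +_)
      l : ℕ
      l = ℓ (suc j)
      instance
        l≢0 : NonZero l
        l≢0 = ℓ≢0 (suc j)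
      c r : ℕ
      c = m / l
      r = m % l
      m≡ : m ≡ c * l + r
      m≡ = trans (m≡m%n+[m/n]*n m l) (+-comm r (c * l))
      swap : ∀ a b c → a * (b * c) ≡ b * (a * c)
      swap = solve-∀

    -- 11 = 1 + 2 + 8: the initial segment, absorbed by the hypothesis on `K * start M`, then the
    -- complete blocks, then the incomplete cycle.
    disc-total : ∀ i m → m < b (suc (M + i)) * ℓ (suc (M + i)) → K * start M ≤ start (suc (M + i)) + m →
                 K * disc e (start (suc (M + i)) + m) ≤ 11 * (Q * (start (suc (M + i)) + m))
    disc-total i m m<T KS≤N = begin
      K * disc e (S + m)                                              ≤⟨ *-monoʳ-≤ K (disc-+ e S m) ⟩
      K * (disc e S + disc (e ∘ (S +_)) m)                            ≡⟨ *-distribˡ-+ K (disc e S) (disc (e ∘ (S +_)) m) ⟩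
      K * disc e S + K * disc (e ∘ (S +_)) m                          ≤⟨ +-mono-≤ before (disc-partial (M + i) m (m≤m+n M i) m<T) ⟩
      Q * (K * start M) + 2 * (Q * S) + (Q * m + 8 * (Q * S))         ≤⟨ +-monoˡ-≤ (Q * m + 8 * (Q * S)) (+-monoˡ-≤ (2 * (Q * S)) (*-monoʳ-≤ Q KS≤N)) ⟩
      -- So far `Q * m` has coefficient 2 and `Q * S` has 11; the added term equalises them.
      Q * (S + m) + 2 * (Q * S) + (Q * m + 8 * (Q * S))               ≤⟨ m≤m+n _ (9 * (Q * m)) ⟩
      Q * (S + m) + 2 * (Q * S) + (Q * m + 8 * (Q * S)) + 9 * (Q * m) ≡⟨ collect Q S m ⟩
      11 * (Q * (S + m))                                              ∎
      where
      open ≤-Reasoning hiding (start)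
      S : ℕ
      S = start (suc (M + i))
      before : K * disc e S ≤ Q * (K * start M) + 2 * (Q * S)
      before = subst (λ j → K * disc e (start j) ≤ Q * (K * start M) + 2 * (Q * start j)) (+-suc M i) (disc-start (suc i))
      collect : ∀ q s m → q * (s + m) + 2 * (q * s) + (q * m + 8 * (q * s)) + 9 * (q * m) ≡ 11 * (q * (s + m))
      collect = solve-∀

-- Growth of n^n and of t.

-- Bernoulli's inequality for (n / (1 + n)) ^ h, cleared of denominators.
bernoulli : ∀ n h → suc n * suc n ^ h ≤ suc n * n ^ h + h * suc n ^ h
bernoulli n zero    = m≤m+n (suc n * 1) 0
bernoulli n (suc h) = begin
  suc n * (suc n * X)                         ≡⟨ e₁ n X ⟩
  n * (suc n * X) + suc n * X                 ≤⟨ +-monoˡ-≤ (suc n * X) (*-monoʳ-≤ n (bernoulli n h)) ⟩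
  n * (suc n * Y + h * X) + suc n * X         ≤⟨ m≤m+n _ (h * X) ⟩
  n * (suc n * Y + h * X) + suc n * X + h * X ≡⟨ e₂ n X Y h ⟩
  suc n * (n * Y) + suc h * (suc n * X)       ∎
  where
  open ≤-Reasoning
  X Y : ℕ
  X = suc n ^ h
  Y = n ^ h
  e₁ : ∀ n x → (1 + n) * ((1 + n) * x) ≡ n * ((1 + n) * x) + (1 + n) * x
  e₁ = solve-∀
  e₂ : ∀ n x y h → n * ((1 + n) * y + h * x) + (1 + n) * x + h * x ≡ (1 + n) * (n * y) + (1 + h) * ((1 + n) * x)
  e₂ = solve-∀

-- By Bernoulli, (n / (n+1))^h is at least 1 - h / (n+1), which is at least 1/2 for these `h`.
suc-^≤2 : ∀ n h → 2 * h ≤ suc n → suc n ^ h ≤ 2 * n ^ h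
suc-^≤2 n h 2h≤ = *-cancelˡ-≤ (suc n) (+-cancelʳ-≤ (suc n * X) (suc n * X) (suc n * (2 * Y)) (begin
  suc n * X + suc n * X                     ≡⟨ e₁ (suc n * X) ⟩
  2 * (suc n * X)                           ≤⟨ *-monoʳ-≤ 2 (bernoulli n h) ⟩
  2 * (suc n * Y + h * X)                   ≡⟨ e₂ (suc n) X Y h ⟩
  suc n * (2 * Y) + 2 * h * X               ≤⟨ +-monoʳ-≤ (suc n * (2 * Y)) (*-monoˡ-≤ X 2h≤) ⟩
  suc n * (2 * Y) + suc n * X               ∎))
  where
  open ≤-Reasoning
  X Y : ℕ
  X = suc n ^ h
  Y = n ^ h
  e₁ : ∀ x → x + x ≡ 2 * x
  e₁ = solve-∀
  e₂ : ∀ n x y h → 2 * (n * y + h * x) ≡ n * (2 * y) + 2 * h * x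
  e₂ = solve-∀

-- A crude substitute for (1 + 1/n)^n < e: the exponent is split into two halves, each of which
-- contributes a factor 2. The larger half can be (n+1)/2, just within the range of `suc-^≤2`.
suc-^≤4 : ∀ n → suc n ^ n ≤ 4 * n ^ n
suc-^≤4 n = begin
  suc n ^ n                        ≡⟨ cong (suc n ^_) split ⟨
  suc n ^ (h + h′)                 ≡⟨ ^-distribˡ-+-* (suc n) h h′ ⟩
  suc n ^ h * suc n ^ h′           ≤⟨ *-mono-≤ (suc-^≤2 n h 2h≤) (suc-^≤2 n h′ 2h′≤) ⟩
  2 * n ^ h * (2 * n ^ h′)         ≡⟨ collect (n ^ h) (n ^ h′) ⟩
  4 * (n ^ h * n ^ h′)             ≡⟨ cong (4 *_) (^-distribˡ-+-* n h h′) ⟨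
  4 * n ^ (h + h′)                 ≡⟨ cong (λ m → 4 * n ^ m) split ⟩
  4 * n ^ n                        ∎
  where
  open ≤-Reasoning
  h h′ : ℕ
  h  = ℕ.⌊ n /2⌋
  h′ = ℕ.⌈ n /2⌉
  double : ∀ m → 2 * m ≡ m + m
  double = solve-∀
  split : h + h′ ≡ n
  split = ⌊n/2⌋+⌈n/2⌉≡n n
  2h≤ : 2 * h ≤ suc n
  2h≤ = ≤-trans (≤-reflexive (double h)) (≤-trans (+-monoʳ-≤ h (⌊n/2⌋≤⌈n/2⌉ n)) (≤-trans (≤-reflexive split) (n≤1+n n)))
  2h′≤ : 2 * h′ ≤ suc n
  2h′≤ = ≤-trans (≤-reflexive (double h′)) (≤-trans (+-monoʳ-≤ h′ (⌊n/2⌋≤⌈n/2⌉ (suc n))) (≤-reflexive (⌊n/2⌋+⌈n/2⌉≡n (suc n))))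
  collect : ∀ x y → 2 * x * (2 * y) ≡ 4 * (x * y)
  collect = solve-∀

-- The 8 is 4 from `suc-^≤4` times 2 from n + 1 ≤ 2n.
suc-^-suc≤ : ∀ n .{{_ : NonZero n}} → suc n ^ suc n ≤ 8 * (n * n ^ n)
suc-^-suc≤ n = begin
  suc n * suc n ^ n          ≤⟨ *-mono-≤ (+-monoˡ-≤ n (ℕ.>-nonZero⁻¹ n)) (suc-^≤4 n) ⟩
  (n + n) * (4 * n ^ n)      ≡⟨ collect n (n ^ n) ⟩
  8 * (n * n ^ n)            ∎
  where
  open ≤-Reasoning
  collect : ∀ n x → (n + n) * (4 * x) ≡ 8 * (n * x)
  collect = solve-∀

n≤n^n : ∀ n → n ≤ n ^ n
n≤n^n zero      = z≤n
n≤n^n n@(suc m) = m≤m*n n (n ^ m) {{m^n≢0 n m}}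

-- The limit is applied with ε = 1/K and denominators are cleared.
t-dominates : ∀ (t : ℕ → ℕ) → (∀ n → 1 ≤ n → 1 ≤ t n) →
  ((ε : ℚ) → 0ℚ ℚ.< ε → ∃ λ N₀ → (n : ℕ) → N₀ ≤ n → 1 ≤ n → frac n (t n) ℚ.< ε) →
  ∀ K .{{_ : NonZero K}} → ∃ λ N₀ → ∀ n → N₀ ≤ n → 1 ≤ n → K * n ≤ t n
t-dominates t 1≤t lim K@(suc k) with lim (frac 1 K) (ℚ.positive⁻¹ (frac 1 K) {{ℚ.normalize-pos 1 K}})
... | N₀ , small = N₀ , λ n N₀≤n 1≤n → <⇒≤ (≤-trans
  (frac<frac⇒ {n} {t n} {1} {K} {{ℕ.>-nonZero (1≤t n 1≤n)}} (small n N₀≤n 1≤n)) (≤-reflexive (*-identityˡ (t n))))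

-- The gap between 11 and 12 supplies the strict inequality that `∣frac-p∣<ε` requires.
cancel-12 : ∀ D d X → 1 ≤ X → 12 * d * D ≤ 11 * X → D * d < X
cancel-12 D d X 1≤X le = *-cancelˡ-< 12 (D * d) X (begin-strict
  12 * (D * d)     ≡⟨ regroup D d ⟩
  12 * d * D       ≤⟨ le ⟩
  11 * X           <⟨ *-monoˡ-< X {{ℕ.>-nonZero 1≤X}} (n<1+n 11) ⟩
  12 * X           ∎)
  where
  open ≤-Reasoning
  regroup : ∀ x y → 12 * (x * y) ≡ 12 * y * x
  regroup = solve-∀

-- The estimates applied to the sequence L.

module _ (F : ℕ → List ℕ) (deBruijn : ∀ n → 1 ≤ n → IsDeBruijn n n (F n))
  (t : ℕ → ℕ) (1≤t : ∀ n → 1 ≤ n → 1 ≤ t n)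
  (t-dom : ∀ K .{{_ : NonZero K}} → ∃ λ N₀ → ∀ n → N₀ ≤ n → 1 ≤ n → K * n ≤ t n)
  where

  private
    ℓ b : ℕ → ℕ
    ℓ j = length (F (suc j))
    b j = t (suc j)

    ℓ≡ : ∀ j → ℓ j ≡ suc j ^ suc j
    ℓ≡ j = proj₁ (deBruijn (suc j) (s≤s z≤n))

    F≢[] : ∀ n → 1 ≤ n → NonZero (length (F n))
    F≢[] (suc j) _ = subst NonZero (sym (ℓ≡ j)) (m^n≢0 (suc j) (suc j))

    instance
      ℓ≢0 : ∀ {j} → NonZero (ℓ j)
      ℓ≢0 {j} = F≢[] (suc j) (s≤s z≤n)

  open Blocks F t

  module _ (k : ℕ) (u v : Fin k → ℚ) (E : BoxEstimate k u v) (K : ℕ) .{{_ : NonZero K}} where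
    open BoxEstimate E
    open Discrepancy Q W W≤Q

    private
      e : ℕ → Bool
      e i = inBox k u v (λ d → L F t (i + toℕ d))

    -- The relative error `k / n` of a cycle is at most `1 / K` once `K * k ≤ n`.
    disc-cycle : ∀ j → K * k ≤ suc j →
      K * disc (λ i → wordInBox k u v (suc j) (cyclicWindow (F (suc j)) i (suc j))) (ℓ j) ≤ Q * ℓ j
    disc-cycle j Kk≤n = subst (λ l → K * disc g l ≤ Q * l) (sym (ℓ≡ j)) (*-cancelʳ-≤ (K * disc g X) (Q * X) n (begin
      K * disc g X * n                                                  ≡⟨ *-assoc K (disc g X) n ⟩
      K * (disc g X * n)                                                ≡⟨ cong (λ c → K * (∣ Q * c - W * X ∣ * n)) (countBelow-windows (deBruijn n (s≤s z≤n)) (wordInBox k u v n)) ⟩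
      K * (∣ Q * count (wordInBox k u v n) (words n n) - W * X ∣ * n)   ≤⟨ *-monoʳ-≤ K bound ⟩
      K * (k * (Q * X))                                                 ≡⟨ *-assoc K k (Q * X) ⟨
      K * k * (Q * X)                                                   ≤⟨ *-monoˡ-≤ (Q * X) Kk≤n ⟩
      n * (Q * X)                                                       ≡⟨ *-comm n (Q * X) ⟩
      Q * X * n                                                         ∎))
      where
      open ≤-Reasoning
      n X : ℕ
      n = suc j
      X = n ^ n
      g : ℕ → Bool
      g i = wordInBox k u v n (cyclicWindow (F n) i n)
      k≤n : k ≤ n
      k≤n = ≤-trans (m≤n*m k K) Kk≤n
      bound : ∣ Q * count (wordInBox k u v n) (words n n) - W * X ∣ * n ≤ k * (Q * X)
      -- The `n ∸ k` letters of a window beyond the box dimension are the free ones.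
      bound = subst (λ m → ∣ Q * count (wordInBox k u v n) (words n m) - W * n ^ m ∣ * n ≤ k * (Q * n ^ m))
        (m+[n∸m]≡n k≤n) (estimate n (n ∸ k))

    -- At least one further cycle of the block follows these `c` cycles, and its length is at least
    -- n and hence at least `k`. No window starting in them leaves the block, so they are exactly
    -- periodic.
    disc-cycles : ∀ j c → K * k ≤ suc j → suc c ≤ b j →
                  K * disc (e ∘ (start j +_)) (c * ℓ j) ≤ Q * (c * ℓ j)
    disc-cycles j c Kk≤n c<b = begin
      K * disc (e ∘ (start j +_)) (c * ℓ j)   ≤⟨ *-monoʳ-≤ K (disc-periodic (e ∘ (start j +_)) g (ℓ j) c agree) ⟩
      K * (c * disc g (ℓ j))                  ≡⟨ swap K c (disc g (ℓ j)) ⟩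
      c * (K * disc g (ℓ j))                  ≤⟨ *-monoʳ-≤ c (disc-cycle j Kk≤n) ⟩
      c * (Q * ℓ j)                           ≡⟨ swap c Q (ℓ j) ⟩
      Q * (c * ℓ j)                           ∎
      where
      open ≤-Reasoning hiding (start)
      g : ℕ → Bool
      g i = wordInBox k u v (suc j) (cyclicWindow (F (suc j)) i (suc j))
      swap : ∀ a b c → a * (b * c) ≡ b * (a * c)
      swap = solve-∀
      k≤n : k ≤ suc j
      k≤n = ≤-trans (m≤n*m k K) Kk≤n
      k≤ℓ : k ≤ ℓ j
      k≤ℓ = ≤-trans k≤n (≤-trans (n≤n^n (suc j)) (≤-reflexive (sym (ℓ≡ j))))
      agree : ∀ i → i < c * ℓ j → e (start j + i) ≡ g (i % ℓ j)
      agree i i<cℓ = inBox-L F≢[] 1≤t u v j i k≤n (begin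
        i + k               ≤⟨ +-mono-≤ (<⇒≤ i<cℓ) k≤ℓ ⟩
        c * ℓ j + ℓ j       ≡⟨ +-comm (c * ℓ j) (ℓ j) ⟩
        suc c * ℓ j         ≤⟨ *-monoˡ-≤ (ℓ j) c<b ⟩
        b j * ℓ j           ∎)

    disc-L : ∃ λ N₀ → ∀ N → N₀ ≤ N → K * disc e N ≤ 11 * (Q * N)
    disc-L with t-dom K
    -- The first summand puts `N` in a block after block `M`, so that `growth` applies to the block
    -- before it; the second lets `N` absorb the positions before `start M`.
    ... | T₀ , Kn≤t = start (suc M) + K * start M , bound
      where
      M : ℕ
      -- Beyond `T₀` the function `t` dominates; beyond `K * k` single cycles are well distributed.
      M = T₀ + K * k
      K*n≤b : ∀ j → M ≤ j → K * suc j ≤ b j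
      K*n≤b j M≤j = Kn≤t (suc j) (m≤n⇒m≤1+n (≤-trans (m≤m+n T₀ (K * k)) M≤j)) (s≤s z≤n)
      growth : ∀ j → M ≤ j → K * ℓ (suc j) ≤ 8 * (b j * ℓ j)
      growth j M≤j = begin
        K * ℓ (suc j)                          ≡⟨ cong (K *_) (ℓ≡ (suc j)) ⟩
        K * suc (suc j) ^ suc (suc j)          ≤⟨ *-monoʳ-≤ K (suc-^-suc≤ (suc j)) ⟩
        K * (8 * (suc j * suc j ^ suc j))      ≡⟨ regroup K (suc j) (suc j ^ suc j) ⟩
        8 * (K * suc j * suc j ^ suc j)        ≤⟨ *-monoʳ-≤ 8 (*-mono-≤ (K*n≤b j M≤j) (≤-reflexive (sym (ℓ≡ j)))) ⟩
        8 * (b j * ℓ j)                        ∎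
        where
        open ≤-Reasoning
        regroup : ∀ a n x → a * (8 * (n * x)) ≡ 8 * (a * n * x)
        regroup = solve-∀
      bound : ∀ N → start (suc M) + K * start M ≤ N → K * disc e N ≤ 11 * (Q * N)
      bound N N₀≤N with locate F≢[] 1≤t (suc M) (N ∸ start (suc M))
      ... | i , m , m<T , eq = subst (λ x → K * disc e x ≤ 11 * (Q * x)) (sym N≡)
        (disc-total e K M b ℓ start (λ j → ℓ≢0 {j}) (λ _ → refl)
          (λ j c M≤j → disc-cycles j c (m≤n⇒m≤1+n (≤-trans (m≤n+m (K * k) T₀) M≤j)))
          (λ j M≤j → ≤-trans (m≤m*n K (suc j)) (K*n≤b j M≤j))
          (λ j → 1≤t (suc j) (s≤s z≤n)) growth i m m<T
          (≤-trans (m≤n+m (K * start M) (start (suc M))) (≤-trans N₀≤N (≤-reflexive N≡))))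
        where
        N≡ : N ≡ start (suc (M + i)) + m
        N≡ = trans (sym (m+[n∸m]≡n (≤-trans (m≤m+n (start (suc M)) (K * start M)) N₀≤N))) eq

  L-completelyUD : CompletelyUD (L F t)
  L-completelyUD k _ u v box ε 0<ε = proj₁ D , λ N N₀≤N 1≤N →
    ∣frac-p∣<ε (countIn (L F t) k u v N) N Q W {{ℕ.>-nonZero 1≤N}} {{Q≢0}} volume-Q 0<ε
      (cancel-12 _ (↧ₙ ε) (Q * N) (*-mono-≤ (ℕ.>-nonZero⁻¹ Q {{Q≢0}}) 1≤N) (proj₂ D N N₀≤N))
    where
    E : BoxEstimate k u v
    E = box-estimate k u v box
    open BoxEstimate E
    open Discrepancy using (disc)
    D : ∃ λ N₀ → ∀ N → N₀ ≤ N → 12 * ↧ₙ ε * disc Q W W≤Q (λ i → inBox k u v (λ d → L F t (i + toℕ d))) N ≤ 11 * (Q * N)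
    -- The factor `↧ₙ ε` accounts for the tolerance, and 12 is chosen to exceed the 11 of `disc-L`.
    D = disc-L k u v E (12 * ↧ₙ ε) {{m*n≢0 12 (↧ₙ ε)}}

theorem1 : (F : ℕ → List ℕ) → ((n : ℕ) → 1 ≤ n → IsFord n n (F n)) →
    (t : ℕ → ℕ) → ((n : ℕ) → 1 ≤ n → 1 ≤ t n) →
    ((m n : ℕ) → 1 ≤ m → m ≤ n → t m ≤ t n) →
    ((ε : ℚ) → 0ℚ Data.Rational.< ε → ∃ λ N₀ → (n : ℕ) → N₀ ≤ n → 1 ≤ n →
    frac n (t n) Data.Rational.< ε) →
    CompletelyUD (L F t)
theorem1 F ford t 1≤t _ lim = L-completelyUD F (λ n 1≤n → proj₁ (ford n 1≤n)) t 1≤t (t-dominates t 1≤t lim)
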